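{- Let $k\ge 2$ and let $\mathbb{R}^+=H_1\sqcup\cdots\sqcup H_k$ be a partition of the positive reals into pairwise disjoint nonempty subsets, each closed under addition and multiplication. Then at least one of the sets $H_i$ is not Lebesgue measurable. -}

module Defs where

open import Data.Nat.Base as ℕ using (ℕ; zero; suc)
import Data.Nat.Properties as ℕₚ
open import Data.Product using (Σ-syntax; ∃-syntax; _×_; _,_)
open import Data.Rational.Base as ℚ using (ℚ; 0ℚ; 1ℚ; ½; ∣_∣)
import Data.Rational.Properties as ℚₚ
open import Data.Rational.Solver using (module +-*-Solver)
open import Level using (0ℓ) renaming (suc to lsuc)
open import Relation.Binary.Core using (Rel)
open import Relation.Binary.Definitions using (_Respects_)
open import Relation.Binary.PropositionalEquality
  using (_≡_; refl; sym; trans; cong; cong₂; subst)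
open import Relation.Nullary.Construct.Add.Supremum using (_⁺; [_]; ⊤⁺)
open import Relation.Unary using (Pred; _∈_; _⊆_; _∩_; _∖_; ⋃)

------------------------------------------------------------------------
-- Real numbers as Cauchy sequences of rationals, with equality _≃_.

IsCauchy : (ℕ → ℚ) → Set
IsCauchy s = ∀ ε → 0ℚ ℚ.< ε →
  ∃[ N ] (∀ m n → N ℕ.≤ m → N ℕ.≤ n → ∣ s m ℚ.- s n ∣ ℚ.< ε)

record ℝ : Set where
  constructor mkℝ
  field
    seq    : ℕ → ℚ
    cauchy : IsCauchy seq

open ℝ public

Eventually : Pred ℕ 0ℓ → Set
Eventually P = ∃[ N ] (∀ n → N ℕ.≤ n → P n)

infix 4 _≃_ _<_ _≤_

_≃_ : Rel ℝ 0ℓ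
x ≃ y = ∀ ε → 0ℚ ℚ.< ε → Eventually λ n → ∣ seq x n ℚ.- seq y n ∣ ℚ.< ε

_<_ : Rel ℝ 0ℓ
x < y = ∃[ ε ] (0ℚ ℚ.< ε × Eventually λ n → seq x n ℚ.+ ε ℚ.≤ seq y n)

_≤_ : Rel ℝ 0ℓ
x ≤ y = ∀ ε → 0ℚ ℚ.< ε → Eventually λ n → seq x n ℚ.≤ seq y n ℚ.+ ε

private
  open +-*-Solver using (solve; _:+_; _:-_; _:*_; :-_; _:=_; con)

half+half : ∀ ε → ½ ℚ.* ε ℚ.+ ½ ℚ.* ε ≡ ε
half+half = solve 1 (λ e → con ½ :* e :+ con ½ :* e := e) refl

half-pos : ∀ {ε} → 0ℚ ℚ.< ε → 0ℚ ℚ.< ½ ℚ.* ε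
half-pos {ε} 0<ε =
  subst (ℚ._< ½ ℚ.* ε) (ℚₚ.*-zeroʳ ½) (ℚₚ.*-monoʳ-<-pos ½ 0<ε)

+-cauchy : ∀ {s t} → IsCauchy s → IsCauchy t → IsCauchy (λ n → s n ℚ.+ t n)
+-cauchy {s} {t} cs ct ε 0<ε
  with M , hs ← cs (½ ℚ.* ε) (half-pos 0<ε)
     | N , ht ← ct (½ ℚ.* ε) (half-pos 0<ε)
  = M ℕ.⊔ N , λ m n p q → begin-strict
    ∣ (s m ℚ.+ t m) ℚ.- (s n ℚ.+ t n) ∣
      ≡⟨ cong ∣_∣ (solve 4 (λ a b c d →
           (a :+ b) :- (c :+ d) := (a :- c) :+ (b :- d)) refl (s m) (t m) (s n) (t n)) ⟩
    ∣ (s m ℚ.- s n) ℚ.+ (t m ℚ.- t n) ∣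
      ≤⟨ ℚₚ.∣p+q∣≤∣p∣+∣q∣ (s m ℚ.- s n) (t m ℚ.- t n) ⟩
    ∣ s m ℚ.- s n ∣ ℚ.+ ∣ t m ℚ.- t n ∣
      <⟨ ℚₚ.+-mono-<
           (hs m n (ℕₚ.m⊔n≤o⇒m≤o M N p) (ℕₚ.m⊔n≤o⇒m≤o M N q))
           (ht m n (ℕₚ.m⊔n≤o⇒n≤o M N p) (ℕₚ.m⊔n≤o⇒n≤o M N q)) ⟩
    ½ ℚ.* ε ℚ.+ ½ ℚ.* ε
      ≡⟨ half+half ε ⟩
    ε ∎
  where open ℚₚ.≤-Reasoning

neg-cauchy : ∀ {s} → IsCauchy s → IsCauchy (λ n → ℚ.- s n)
neg-cauchy {s} cs ε 0<ε with N , h ← cs ε 0<ε =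
  N , λ m n p q → subst (ℚ._< ε) (eq m n) (h m n p q)
  where
  eq : ∀ m n → ∣ s m ℚ.- s n ∣ ≡ ∣ (ℚ.- s m) ℚ.- (ℚ.- s n) ∣
  eq m n = trans (sym (ℚₚ.∣-p∣≡∣p∣ (s m ℚ.- s n)))
    (cong ∣_∣ (solve 2 (λ a b → :- (a :- b) := (:- a) :- (:- b)) refl (s m) (s n)))

bounded : ∀ {s} → IsCauchy s →
  ∃[ B ] (0ℚ ℚ.< B × Eventually λ n → ∣ s n ∣ ℚ.≤ B)
bounded {s} cs with N , h ← cs 1ℚ (ℚₚ.positive⁻¹ 1ℚ) =
  1ℚ ℚ.+ ∣ s N ∣ ,
  ℚₚ.+-mono-<-≤ (ℚₚ.positive⁻¹ 1ℚ) (ℚₚ.0≤∣p∣ (s N)) ,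
  N , λ n p → begin
    ∣ s n ∣
      ≡⟨ cong ∣_∣ (solve 2 (λ a b → a := (a :- b) :+ b) refl (s n) (s N)) ⟩
    ∣ (s n ℚ.- s N) ℚ.+ s N ∣
      ≤⟨ ℚₚ.∣p+q∣≤∣p∣+∣q∣ (s n ℚ.- s N) (s N) ⟩
    ∣ s n ℚ.- s N ∣ ℚ.+ ∣ s N ∣
      ≤⟨ ℚₚ.+-monoˡ-≤ ∣ s N ∣ (ℚₚ.<⇒≤ (h n N p ℕₚ.≤-refl)) ⟩
    1ℚ ℚ.+ ∣ s N ∣ ∎
  where open ℚₚ.≤-Reasoning

scaled : ∀ {B ε} → 0ℚ ℚ.< B → 0ℚ ℚ.< ε →
  ∃[ δ ] (0ℚ ℚ.< δ × B ℚ.* δ ≡ ½ ℚ.* ε)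
scaled {B} {ε} 0<B 0<ε = δ , ℚₚ.positive⁻¹ δ , eq
  where
  instance
    B-pos = ℚ.positive 0<B
    B-nz  = ℚₚ.pos⇒nonZero B
    i-pos = ℚₚ.1/pos⇒pos B
    h-pos = ℚ.positive (half-pos 0<ε)
  δ = ℚ.1/ B ℚ.* (½ ℚ.* ε)
  instance
    δ-pos = ℚₚ.pos*pos⇒pos (ℚ.1/ B) (½ ℚ.* ε)
  eq : B ℚ.* δ ≡ ½ ℚ.* ε
  eq = trans (sym (ℚₚ.*-assoc B (ℚ.1/ B) (½ ℚ.* ε)))
    (trans (cong (ℚ._* (½ ℚ.* ε)) (ℚₚ.*-inverseʳ B)) (ℚₚ.*-identityˡ (½ ℚ.* ε)))

*-bound : ∀ B δ a d → 0ℚ ℚ.< B → ∣ a ∣ ℚ.≤ B → ∣ d ∣ ℚ.< δ →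
  ∣ a ℚ.* d ∣ ℚ.< B ℚ.* δ
*-bound B δ a d 0<B a≤B d<δ = begin-strict
  ∣ a ℚ.* d ∣      ≡⟨ ℚₚ.∣p*q∣≡∣p∣*∣q∣ a d ⟩
  ∣ a ∣ ℚ.* ∣ d ∣  ≤⟨ ℚₚ.*-monoʳ-≤-nonNeg ∣ d ∣ {{ℚₚ.∣-∣-nonNeg d}} a≤B ⟩
  B ℚ.* ∣ d ∣      <⟨ ℚₚ.*-monoʳ-<-pos B {{ℚ.positive 0<B}} d<δ ⟩
  B ℚ.* δ          ∎
  where open ℚₚ.≤-Reasoning

*-split : ∀ a b c d →
  a ℚ.* b ℚ.- c ℚ.* d ≡ a ℚ.* (b ℚ.- d) ℚ.+ d ℚ.* (a ℚ.- c)
*-split = solve 4 (λ a b c d →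
  a :* b :- c :* d := a :* (b :- d) :+ d :* (a :- c)) refl

*-close : ∀ {A B α β ε} a b c d → 0ℚ ℚ.< A → 0ℚ ℚ.< B →
  A ℚ.* α ≡ ½ ℚ.* ε → B ℚ.* β ≡ ½ ℚ.* ε →
  ∣ a ∣ ℚ.≤ A → ∣ d ∣ ℚ.≤ B → ∣ b ℚ.- d ∣ ℚ.< α → ∣ a ℚ.- c ∣ ℚ.< β →
  ∣ a ℚ.* b ℚ.- c ℚ.* d ∣ ℚ.< ε
*-close {A} {B} {α} {β} {ε} a b c d 0<A 0<B Aα Bβ a≤A d≤B bd ac = begin-strict
  ∣ a ℚ.* b ℚ.- c ℚ.* d ∣
    ≡⟨ cong ∣_∣ (*-split a b c d) ⟩
  ∣ a ℚ.* (b ℚ.- d) ℚ.+ d ℚ.* (a ℚ.- c) ∣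
    ≤⟨ ℚₚ.∣p+q∣≤∣p∣+∣q∣ (a ℚ.* (b ℚ.- d)) (d ℚ.* (a ℚ.- c)) ⟩
  ∣ a ℚ.* (b ℚ.- d) ∣ ℚ.+ ∣ d ℚ.* (a ℚ.- c) ∣
    <⟨ ℚₚ.+-mono-< (*-bound A α a (b ℚ.- d) 0<A a≤A bd)
                   (*-bound B β d (a ℚ.- c) 0<B d≤B ac) ⟩
  A ℚ.* α ℚ.+ B ℚ.* β
    ≡⟨ cong₂ ℚ._+_ Aα Bβ ⟩
  ½ ℚ.* ε ℚ.+ ½ ℚ.* ε
    ≡⟨ half+half ε ⟩
  ε ∎
  where open ℚₚ.≤-Reasoning

*-cauchy : ∀ {s t} → IsCauchy s → IsCauchy t → IsCauchy (λ n → s n ℚ.* t n)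
*-cauchy {s} {t} cs ct ε 0<ε =
  let A , 0<A , K , hA = bounded cs
      B , 0<B , L , hB = bounded ct
      α , 0<α , Aα     = scaled 0<A 0<ε
      β , 0<β , Bβ     = scaled 0<B 0<ε
      M , hs           = cs β 0<β
      N , ht           = ct α 0<α
      K⊔L = K ℕ.⊔ L
      M⊔N = M ℕ.⊔ N
  in K⊔L ℕ.⊔ M⊔N , λ m n p q →
    let p₁ = ℕₚ.m⊔n≤o⇒m≤o K⊔L M⊔N p
        p₂ = ℕₚ.m⊔n≤o⇒n≤o K⊔L M⊔N p
        q₁ = ℕₚ.m⊔n≤o⇒m≤o K⊔L M⊔N q
        q₂ = ℕₚ.m⊔n≤o⇒n≤o K⊔L M⊔N q
    in *-close {A} {B} {α} {β} {ε} (s m) (t m) (s n) (t n) 0<A 0<B Aα Bβ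
         (hA m (ℕₚ.m⊔n≤o⇒m≤o K L p₁))
         (hB n (ℕₚ.m⊔n≤o⇒n≤o K L q₁))
         (ht m n (ℕₚ.m⊔n≤o⇒n≤o M N p₂) (ℕₚ.m⊔n≤o⇒n≤o M N q₂))
         (hs m n (ℕₚ.m⊔n≤o⇒m≤o M N p₂) (ℕₚ.m⊔n≤o⇒m≤o M N q₂))

const-cauchy : ∀ q → IsCauchy (λ _ → q)
const-cauchy q ε 0<ε =
  0 , λ _ _ _ _ → subst (λ r → ∣ r ∣ ℚ.< ε) (sym (ℚₚ.+-inverseʳ q)) 0<ε

infixl 6 _+_ _-_
infixl 7 _*_
infix  8 -_

0ℝ : ℝ
0ℝ = mkℝ (λ _ → 0ℚ) (const-cauchy 0ℚ)

_+_ : ℝ → ℝ → ℝ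
x + y = mkℝ (λ n → seq x n ℚ.+ seq y n)
  (+-cauchy {seq x} {seq y} (cauchy x) (cauchy y))

-_ : ℝ → ℝ
- x = mkℝ (λ n → ℚ.- seq x n) (neg-cauchy {seq x} (cauchy x))

_-_ : ℝ → ℝ → ℝ
x - y = x + (- y)

_*_ : ℝ → ℝ → ℝ
x * y = mkℝ (λ n → seq x n ℚ.* seq y n)
  (*-cauchy {seq x} {seq y} (cauchy x) (cauchy y))

ℝ⁺ : Pred ℝ 0ℓ
ℝ⁺ x = 0ℝ < x

-- A subset of the real line is a predicate P that does not distinguish
-- equal reals, i.e. one satisfying IsSubset P.
IsSubset : Pred ℝ 0ℓ → Set
IsSubset P = P Respects _≃_

------------------------------------------------------------------------
-- Lebesgue measurability. Lengths and measures take values in ℝ∞, where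
-- ⊤⁺ is +∞.

ℝ∞ : Set
ℝ∞ = ℝ ⁺

open import Relation.Binary.Construct.Add.Supremum.Equality _≃_ public
  using () renaming (_≈⁺_ to _≃∞_)
open import Relation.Binary.Construct.Add.Supremum.NonStrict _≤_ public
  using () renaming (_≤⁺_ to _≤∞_)

infixl 6 _+∞_

_+∞_ : ℝ∞ → ℝ∞ → ℝ∞
[ x ] +∞ [ y ] = [ x + y ]
[ _ ] +∞ ⊤⁺    = ⊤⁺
⊤⁺    +∞ _     = ⊤⁺

IsSup : Pred ℝ∞ 0ℓ → ℝ∞ → Set
IsSup P s = (∀ p → P p → p ≤∞ s) × (∀ u → (∀ p → P p → p ≤∞ u) → s ≤∞ u)

IsInf : Pred ℝ∞ 0ℓ → ℝ∞ → Set
IsInf P m = (∀ p → P p → m ≤∞ p) × (∀ l → (∀ p → P p → l ≤∞ p) → l ≤∞ m)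

record Interval : Set where
  field
    left right : ℝ
    left≤right : left ≤ right

open Interval public

Interior : Interval → Pred ℝ 0ℓ
Interior I x = left I < x × x < right I

len : Interval → ℝ
len I = right I - left I

partialSum : (ℕ → ℝ) → ℕ → ℝ
partialSum a zero    = 0ℝ
partialSum a (suc n) = partialSum a n + a n

-- The sum in [0,∞] of a series of nonnegative terms.
HasSum : (ℕ → ℝ) → ℝ∞ → Set
HasSum a = IsSup (λ p → ∃[ n ] p ≡ [ partialSum a n ])

CoverLength : Pred ℝ 0ℓ → Pred ℝ∞ 0ℓ
CoverLength E s = Σ[ I ∈ (ℕ → Interval) ]
  (E ⊆ ⋃ ℕ (λ n → Interior (I n)) × HasSum (λ n → len (I n)) s)

-- OuterMeasure E m says that m is the Lebesgue outer measure of E. It is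
-- a relation because suprema and infima exist only classically; they are
-- unique up to _≃∞_.
OuterMeasure : Pred ℝ 0ℓ → ℝ∞ → Set
OuterMeasure E = IsInf (CoverLength E)

-- Carathéodory's criterion.
LebesgueMeasurable : Pred ℝ 0ℓ → Set (lsuc 0ℓ)
LebesgueMeasurable A = ∀ (E : Pred ℝ 0ℓ) → IsSubset E → ∀ m m₁ m₂ →
  OuterMeasure E m → OuterMeasure (E ∩ A) m₁ → OuterMeasure (E ∖ A) m₂ →
  m ≃∞ m₁ +∞ m₂

{-# OPTIONS --safe #-}
-- Only closure under addition is used. Let A be one of the parts and suppose that it is measurable.
-- A positive rational multiple of a point stays in its part, so every part is dense in ℝ⁺ and
-- each a + b is approximated by points t outside A. The reflection x ↦ t - x maps A ∩ (a , b) into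
-- the complement of A and almost into (a , b), so Carathéodory's criterion for (a , b) bounds the
-- outer measure of A ∩ (a , b) by 3/4 (b - a). Applying this to each interval of a cover shrinks
-- the cover by 3/4, hence A ∩ (0 , 4) is null. If all parts were measurable, (0 , 4) would be a
-- finite union of null sets, which is impossible because a cover of [1 , 3] has length at least 2.
module Submission where

open import Defs
open import Axiom.ExcludedMiddle using (ExcludedMiddle)
open import Data.Empty using (⊥-elim)
open import Data.Fin.Base as Fin using (Fin; toℕ; fromℕ<)
import Data.Fin.Properties as Finₚ
open import Data.Integer.Base as ℤ using (+_)
import Data.Integer.Properties as ℤₚ
open import Data.Nat.Base as ℕ using (ℕ; zero; suc)
import Data.Nat.Properties as ℕₚ
open import Data.Product using (Σ-syntax; ∃-syntax; _×_; _,_; proj₁; proj₂)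
open import Data.Rational.Base as ℚ using (ℚ; mkℚ; 0ℚ; 1ℚ; ½; ∣_∣)
import Data.Rational.Properties as ℚₚ
open import Data.Rational.Solver using (module +-*-Solver)
open import Data.Rational.Unnormalised.Base as ℚᵘ using (mkℚᵘ; *≡*)
import Data.Rational.Unnormalised.Properties as ℚᵘₚ
open import Data.Sum.Base using (_⊎_; inj₁; inj₂)
open import Data.Unit using (tt)
open import Function.Base using (_∘_)
open import Level using (0ℓ; Lift; lift; lower) renaming (suc to lsuc)
open import Relation.Binary.Construct.Add.Supremum.Equality _≃_ using ([_])
open import Relation.Binary.Construct.Add.Supremum.NonStrict _≤_
  using ([_]; _≤⊤⁺; [≤]-injective; ≤⁺-trans)
open import Relation.Binary.PropositionalEquality
  using (_≡_; _≢_; refl; sym; trans; cong; cong₂; subst; subst₂)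
open import Relation.Nullary using (¬_; Dec; yes; no)
open import Relation.Nullary.Construct.Add.Supremum using ([_]; ⊤⁺)
open import Relation.Nullary.Decidable using (map′; toWitness; decidable-stable)
open import Relation.Unary using (Pred; _∈_; _⊆_; _≐_; _∩_; _∖_; ⋃; Empty; Satisfiable)

-- If `x` and `t - x` both lay in `A`, so would their sum `t`. Hence for `t` outside `A` the
-- reflected copy of `A ∩ (a , b)` avoids `A`, and the outer measure of `A ∩ (a , b)` is, up to
-- small errors, bounded by each of the two summands in Carathéodory's equation, thus by half the
-- length. The fraction 3/4 leaves room for the errors. It depends neither on the position nor on
-- the length of the interval, which is why it acts on all intervals of a cover at once and can be
-- iterated. The obstacle is the encoding of the reals: order between Cauchy sequences is known only
-- up to arbitrary errors, infima have to be built, and the criterion speaks only of numbers already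
-- shown to be outer measures. Outer measures are therefore constructed by classical bisection and
-- used only to apply the criterion, in `split`. The other estimates concern covers with rational
-- endpoints and a rational bound on their partial sums. The same bisection yields the compactness
-- of a closed interval.

open +-*-Solver using (solve; _:+_; _:-_; _:*_; :-_; _:=_; con)

-- Rational arithmetic and bisection

-- A linear inequality p ≤ q is proved by writing q - p as a nonnegative combination of the
-- differences supplied by gap, which turns it into a ring identity.
gap : ∀ {p q} → p ℚ.≤ q → 0ℚ ℚ.≤ q ℚ.- p
gap {p} {q} p≤q =
  subst (ℚ._≤ q ℚ.- p) (ℚₚ.+-inverseʳ p) (ℚₚ.+-monoˡ-≤ (ℚ.- p) p≤q)

≤-gap : ∀ {p q d} → 0ℚ ℚ.≤ d → q ℚ.- p ≡ d → p ℚ.≤ q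
≤-gap {p} {q} {d} 0≤d eq = subst₂ ℚ._≤_ (ℚₚ.+-identityˡ p)
  (trans (cong (ℚ._+ p) (sym eq)) (solve 2 (λ p q → q :- p :+ p := q) refl p q))
  (ℚₚ.+-monoˡ-≤ p 0≤d)

infixl 6 _⊕_
_⊕_ : ∀ {p q} → 0ℚ ℚ.≤ p → 0ℚ ℚ.≤ q → 0ℚ ℚ.≤ p ℚ.+ q
_⊕_ = ℚₚ.+-mono-≤

infixr 7 _⊛_
_⊛_ : ∀ {p q} → 0ℚ ℚ.≤ p → 0ℚ ℚ.≤ q → 0ℚ ℚ.≤ p ℚ.* q
_⊛_ {p} {q} 0≤p 0≤q = ℚₚ.nonNegative⁻¹ _
  {{ℚₚ.nonNeg*nonNeg⇒nonNeg p {{ℚ.nonNegative 0≤p}} q {{ℚ.nonNegative 0≤q}}}}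

0≤½ : 0ℚ ℚ.≤ ½
0≤½ = ℚₚ.nonNegative⁻¹ ½

*-pos : ∀ {p q} → 0ℚ ℚ.< p → 0ℚ ℚ.< q → 0ℚ ℚ.< p ℚ.* q
*-pos {p} {q} 0<p 0<q =
  ℚₚ.positive⁻¹ _ {{ℚₚ.pos*pos⇒pos p {{ℚ.positive 0<p}} q {{ℚ.positive 0<q}}}}

divide : ∀ {p} q → 0ℚ ℚ.< p → ∃[ r ] p ℚ.* r ≡ q
divide {p} q 0<p = ℚ.1/ p ℚ.* q ,
  trans (sym (ℚₚ.*-assoc p (ℚ.1/ p) q))
    (trans (cong (ℚ._* q) (ℚₚ.*-inverseʳ p)) (ℚₚ.*-identityˡ q))
  where instance _ = ℚₚ.pos⇒nonZero p {{ℚ.positive 0<p}}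

*-cancel-≤ : ∀ {p q r} → 0ℚ ℚ.< r → r ℚ.* p ℚ.≤ r ℚ.* q → p ℚ.≤ q
*-cancel-≤ {r = r} 0<r = ℚₚ.*-cancelˡ-≤-pos r {{ℚ.positive 0<r}}

*-cancel-pos : ∀ {q r} → 0ℚ ℚ.≤ r → 0ℚ ℚ.< r ℚ.* q → 0ℚ ℚ.< q
*-cancel-pos {q} {r} 0≤r 0<rq = ℚₚ.*-cancelˡ-<-nonNeg r {{ℚ.nonNegative 0≤r}}
  (subst (ℚ._< r ℚ.* q) (sym (ℚₚ.*-zeroʳ r)) 0<rq)

fromℕ : ℕ → ℚ
fromℕ n = + n ℚ./ 1

-- The division by 1 normalises through a gcd that does not reduce for a variable `n`, so the
-- identity is checked on unnormalised rationals.
fromℕ-suc : ∀ n → fromℕ (suc n) ≡ 1ℚ ℚ.+ fromℕ n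
fromℕ-suc n = ℚₚ.toℚᵘ-injective (begin
  ℚ.toℚᵘ (fromℕ (suc n))
    ≈⟨ ℚₚ.toℚᵘ-fromℚᵘ (mkℚᵘ (+ suc n) 0) ⟩
  mkℚᵘ (+ suc n) 0
    ≈⟨ *≡* (cong (λ k → (+ 1 ℤ.+ k) ℤ.* + 1) (sym (ℤₚ.*-identityʳ (+ n)))) ⟩
  ℚᵘ.1ℚᵘ ℚᵘ.+ mkℚᵘ (+ n) 0
    ≈⟨ ℚᵘₚ.+-congʳ ℚᵘ.1ℚᵘ (ℚᵘₚ.≃-sym (ℚₚ.toℚᵘ-fromℚᵘ (mkℚᵘ (+ n) 0))) ⟩
  ℚᵘ.1ℚᵘ ℚᵘ.+ ℚ.toℚᵘ (fromℕ n)
    ≈⟨ ℚᵘₚ.≃-sym (ℚₚ.toℚᵘ-homo-+ 1ℚ (fromℕ n)) ⟩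
  ℚ.toℚᵘ (1ℚ ℚ.+ fromℕ n) ∎)
  where open ℚᵘₚ.≃-Reasoning

-- Numerator and denominator of `q`. Cleared of division, the equation lets natural multiples, which
-- addition controls, stand in for rational ones.
positive-fraction : ∀ {q} → 0ℚ ℚ.< q →
  ∃[ m ] ∃[ n ] fromℕ (suc n) ℚ.* q ≡ fromℕ (suc m)
positive-fraction {mkℚ (ℤ.+[1+ m ]) d c} _ = m , d , ℚₚ.toℚᵘ-injective (begin
  ℚ.toℚᵘ (fromℕ (suc d) ℚ.* q)
    ≈⟨ ℚₚ.toℚᵘ-homo-* (fromℕ (suc d)) q ⟩
  ℚ.toℚᵘ (fromℕ (suc d)) ℚᵘ.* ℚ.toℚᵘ q
    ≈⟨ ℚᵘₚ.*-congʳ (ℚₚ.toℚᵘ-fromℚᵘ (mkℚᵘ (+ suc d) 0)) ⟩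
  mkℚᵘ (+ suc d) 0 ℚᵘ.* mkℚᵘ (+ suc m) d
    ≈⟨ *≡* (trans (ℤₚ.*-identityʳ (+ suc d ℤ.* + suc m))
             (trans (ℤₚ.*-comm (+ suc d) (+ suc m))
               (cong (+ suc m ℤ.*_) (sym (ℤₚ.*-identityˡ (+ suc d)))))) ⟩
  mkℚᵘ (+ suc m) 0
    ≈⟨ ℚᵘₚ.≃-sym (ℚₚ.toℚᵘ-fromℚᵘ (mkℚᵘ (+ suc m) 0)) ⟩
  ℚ.toℚᵘ (fromℕ (suc m)) ∎)
  where
  open ℚᵘₚ.≃-Reasoning
  q = mkℚ (ℤ.+[1+ m ]) d c
positive-fraction {mkℚ (+ 0) d c} (ℚ.*<* (ℤ.+<+ ()))
positive-fraction {mkℚ (ℤ.-[1+ m ]) d c} (ℚ.*<* ())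

0≤fromℕ : ∀ n → 0ℚ ℚ.≤ fromℕ n
0≤fromℕ zero    = ℚₚ.≤-refl
0≤fromℕ (suc n) = subst (0ℚ ℚ.≤_) (sym (fromℕ-suc n))
  (ℚₚ.nonNegative⁻¹ 1ℚ ⊕ 0≤fromℕ n)

-- A positive rational is at most its own numerator.
archimedean : ∀ q → ∃[ n ] q ℚ.≤ fromℕ n
archimedean q with 0ℚ ℚₚ.<? q
... | no  0≮q = 0 , ℚₚ.≮⇒≥ 0≮q
... | yes 0<q with m , n , eq ← positive-fraction 0<q =
  suc m , ≤-gap (0≤fromℕ n ⊛ ℚₚ.<⇒≤ 0<q)
    (trans (cong (ℚ._- q) (trans (sym eq) (cong (ℚ._* q) (fromℕ-suc n))))
      (solve 2 (λ n q → (con 1ℚ :+ n) :* q :- q := n :* q) refl (fromℕ n) q))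

½^ : ℕ → ℚ
½^ zero    = 1ℚ
½^ (suc n) = ½ ℚ.* ½^ n

0<½^ : ∀ n → 0ℚ ℚ.< ½^ n
0<½^ zero    = ℚₚ.positive⁻¹ 1ℚ
0<½^ (suc n) = half-pos (0<½^ n)

½^≤1 : ∀ n → ½^ n ℚ.≤ 1ℚ
½^≤1 zero    = ℚₚ.≤-refl
½^≤1 (suc n) = ≤-gap (0≤½ ⊛ gap (½^≤1 n) ⊕ 0≤½)
  (solve 1 (λ h → con 1ℚ :- con ½ :* h := con ½ :* (con 1ℚ :- h) :+ con ½) refl (½^ n))

n*½^n≤1 : ∀ n → fromℕ n ℚ.* ½^ n ℚ.≤ 1ℚ
n*½^n≤1 zero    = ℚₚ.nonNegative⁻¹ 1ℚ
n*½^n≤1 (suc n) = ≤-gap (0≤½ ⊛ (gap (½^≤1 n) ⊕ gap (n*½^n≤1 n)))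
  (trans (cong (λ k → 1ℚ ℚ.- k ℚ.* (½ ℚ.* ½^ n)) (fromℕ-suc n))
    (solve 2 (λ k h → con 1ℚ :- (con 1ℚ :+ k) :* (con ½ :* h) :=
       con ½ :* ((con 1ℚ :- h) :+ (con 1ℚ :- k :* h))) refl (fromℕ n) (½^ n)))

-- Write `b = ε c` and take `n ≥ c`; then `n ½^n ≤ 1` gives the bound, whatever the sign of `b`.
½^-small : ∀ b {ε} → 0ℚ ℚ.< ε → ∃[ n ] b ℚ.* ½^ n ℚ.≤ ε
½^-small b {ε} 0<ε with c , refl ← divide b 0<ε with n , c≤n ← archimedean c =
  n , ≤-gap (ℚₚ.<⇒≤ 0<ε ⊛ (gap (n*½^n≤1 n) ⊕ gap c≤n ⊛ ℚₚ.<⇒≤ (0<½^ n)))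
    (solve 4 (λ e c k h → e :- e :* c :* h :=
       e :* ((con 1ℚ :- k :* h) :+ (k :- c) :* h)) refl ε c (fromℕ n) (½^ n))

≤-+-gap : ∀ {p q e} → q ℚ.- p ℚ.≤ e → q ℚ.≤ p ℚ.+ e
≤-+-gap {p} {q} {e} h = ≤-gap (gap h)
  (solve 3 (λ p q e → p :+ e :- q := e :- (q :- p)) refl p q e)

within : ∀ {l h e p q} → l ℚ.≤ p × p ℚ.≤ h → l ℚ.≤ q × q ℚ.≤ h →
  h ℚ.≤ l ℚ.+ e → ∣ p ℚ.- q ∣ ℚ.≤ e
within {l} {h} {e} {p} {q} (l≤p , p≤h) (l≤q , q≤h) w with ℚₚ.∣p∣≡p∨∣p∣≡-p (p ℚ.- q)
... | inj₁ eq = subst (ℚ._≤ e) (sym eq) (≤-gap (gap w ⊕ gap p≤h ⊕ gap l≤q)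
  (solve 5 (λ p q l h e → e :- (p :- q) := (l :+ e :- h) :+ (h :- p) :+ (q :- l))
    refl p q l h e))
... | inj₂ eq = subst (ℚ._≤ e) (sym eq) (≤-gap (gap w ⊕ gap q≤h ⊕ gap l≤p)
  (solve 5 (λ p q l h e → e :- (:- (p :- q)) := (l :+ e :- h) :+ (h :- q) :+ (p :- l))
    refl p q l h e))

half< : ∀ {e} → 0ℚ ℚ.< e → ½ ℚ.* e ℚ.< e
half< {e} 0<e = subst₂ ℚ._<_ (ℚₚ.+-identityʳ (½ ℚ.* e)) (half+half e)
  (ℚₚ.+-monoʳ-< (½ ℚ.* e) (half-pos 0<e))

ev-map : ∀ {P Q : Pred ℕ 0ℓ} → (∀ n → P n → Q n) → Eventually P → Eventually Q
ev-map f (N , h) = N , λ n N≤n → f n (h n N≤n)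

ev-zip : ∀ {P Q R : Pred ℕ 0ℓ} → (∀ n → P n → Q n → R n) →
  Eventually P → Eventually Q → Eventually R
ev-zip f (M , g) (N , h) = M ℕ.⊔ N , λ n p →
  f n (g n (ℕₚ.m⊔n≤o⇒m≤o M N p)) (h n (ℕₚ.m⊔n≤o⇒n≤o M N p))

ev-const : ∀ {A : Set} → Eventually (λ _ → A) → A
ev-const (N , h) = h N ℕₚ.≤-refl

midpoint : ℚ → ℚ → ℚ
midpoint p q = ½ ℚ.* (p ℚ.+ q)

midpoint-gapˡ : ∀ p q → midpoint p q ℚ.- p ≡ ½ ℚ.* (q ℚ.- p)
midpoint-gapˡ = solve 2 (λ p q → con ½ :* (p :+ q) :- p := con ½ :* (q :- p)) refl

midpoint-gapʳ : ∀ p q → q ℚ.- midpoint p q ≡ ½ ℚ.* (q ℚ.- p)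
midpoint-gapʳ = solve 2 (λ p q → q :- con ½ :* (p :+ q) := con ½ :* (q :- p)) refl

-- What a bisection leaves behind: a point at which `R` holds on arbitrarily short intervals. A
-- global property of intervals thereby becomes a local one.
Shrinking : (ℚ → ℚ → Set) → Set
Shrinking R = ∃[ x ] (∀ ε → 0ℚ ℚ.< ε →
  ∃[ p ] ∃[ q ] (R p q × q ℚ.≤ p ℚ.+ ε × Eventually λ n → p ℚ.≤ seq x n × seq x n ℚ.≤ q))

module _ (R : ℚ → ℚ → Set)
  (ordered : ∀ {p q} → R p q → p ℚ.≤ q)
  (halve : ∀ {p q} → R p q → R p (midpoint p q) ⊎ R (midpoint p q) q)
  where

  private
    Stage : Set
    Stage = Σ[ p ∈ ℚ ] Σ[ q ∈ ℚ ] R p q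

    lo hi : Stage → ℚ
    lo (p , _ , _) = p
    hi (_ , q , _) = q

    lo≤hi : ∀ s → lo s ℚ.≤ hi s
    lo≤hi (_ , _ , r) = ordered r

    step : Stage → Stage
    step (p , q , r) with halve r
    ... | inj₁ r′ = p , _ , r′
    ... | inj₂ r′ = _ , q , r′

    step-nested : ∀ s → lo s ℚ.≤ lo (step s) × hi (step s) ℚ.≤ hi s
    step-nested (p , q , r) with halve r
    ... | inj₁ r′ = ℚₚ.≤-refl , ≤-gap (0≤½ ⊛ gap (ordered r)) (midpoint-gapʳ p q)
    ... | inj₂ r′ = ≤-gap (0≤½ ⊛ gap (ordered r)) (midpoint-gapˡ p q) , ℚₚ.≤-refl

    step-width : ∀ s → hi (step s) ℚ.- lo (step s) ≡ ½ ℚ.* (hi s ℚ.- lo s)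
    step-width (p , q , r) with halve r
    ... | inj₁ r′ = midpoint-gapˡ p q
    ... | inj₂ r′ = midpoint-gapʳ p q

  private module Stages {a b} (r : R a b) where

    stage : ℕ → Stage
    stage zero    = a , b , r
    stage (suc n) = step (stage n)

    nested : ∀ m k → lo (stage m) ℚ.≤ lo (stage (k ℕ.+ m)) ×
                     hi (stage (k ℕ.+ m)) ℚ.≤ hi (stage m)
    nested m zero    = ℚₚ.≤-refl , ℚₚ.≤-refl
    nested m (suc k) with u , v ← nested m k with u′ , v′ ← step-nested (stage (k ℕ.+ m)) =
      ℚₚ.≤-trans u u′ , ℚₚ.≤-trans v′ v

    inside : ∀ m n → m ℕ.≤ n →
      lo (stage m) ℚ.≤ lo (stage n) × lo (stage n) ℚ.≤ hi (stage m)
    inside m n m≤n with u , v ← nested m (n ℕ.∸ m) rewrite ℕₚ.m∸n+n≡m m≤n =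
      u , ℚₚ.≤-trans (lo≤hi (stage n)) v

    width : ∀ n → hi (stage n) ℚ.- lo (stage n) ≡ (b ℚ.- a) ℚ.* ½^ n
    width zero    = sym (ℚₚ.*-identityʳ (b ℚ.- a))
    width (suc n) = trans (step-width (stage n)) (trans (cong (½ ℚ.*_) (width n))
      (solve 2 (λ w h → con ½ :* (w :* h) := w :* (con ½ :* h)) refl (b ℚ.- a) (½^ n)))

    narrow : ∀ ε → 0ℚ ℚ.< ε → ∃[ n ] hi (stage n) ℚ.≤ lo (stage n) ℚ.+ ε
    narrow ε 0<ε with n , small ← ½^-small (b ℚ.- a) 0<ε =
      n , ≤-+-gap (subst (ℚ._≤ ε) (sym (width n)) small)

    cauchy′ : IsCauchy (λ n → lo (stage n))
    cauchy′ ε 0<ε = N , λ m n N≤m N≤n → ℚₚ.≤-<-trans (bound m n N≤m N≤n) (half< 0<ε)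
      where
      N = proj₁ (narrow (½ ℚ.* ε) (half-pos 0<ε))
      w : hi (stage N) ℚ.≤ lo (stage N) ℚ.+ ½ ℚ.* ε
      w = proj₂ (narrow (½ ℚ.* ε) (half-pos 0<ε))
      bound : ∀ m n → N ℕ.≤ m → N ℕ.≤ n → ∣ lo (stage m) ℚ.- lo (stage n) ∣ ℚ.≤ ½ ℚ.* ε
      bound m n N≤m N≤n = within {lo (stage N)} {hi (stage N)} {½ ℚ.* ε}
        {lo (stage m)} {lo (stage n)} (inside N m N≤m) (inside N n N≤n) w

  -- The limit is the sequence of left endpoints itself. Stage `N` contains all later left
  -- endpoints, so its width controls both the Cauchy condition and the approximation.
  bisect : ∀ {a b} → R a b → Shrinking R
  bisect r = mkℝ (λ n → lo (stage n)) cauchy′ , λ ε 0<ε →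
    let N , w = narrow ε 0<ε in
    lo (stage N) , hi (stage N) , proj₂ (proj₂ (stage N)) , w , N , inside N
    where open Stages r

-- Partial sums and infima of sets of reals

psum : (ℕ → ℚ) → ℕ → ℚ
psum f zero    = 0ℚ
psum f (suc n) = psum f n ℚ.+ f n

psum-front : ∀ f n → psum f (suc n) ≡ f 0 ℚ.+ psum (f ∘ suc) n
psum-front f zero    = ℚₚ.+-comm 0ℚ (f 0)
psum-front f (suc n) = trans (cong (ℚ._+ f (suc n)) (psum-front f n))
  (ℚₚ.+-assoc (f 0) (psum (f ∘ suc) n) (f (suc n)))

psum-≤ : ∀ {f g} → (∀ i → f i ℚ.≤ g i) → ∀ n → psum f n ℚ.≤ psum g n
psum-≤ f≤g zero    = ℚₚ.≤-refl
psum-≤ f≤g (suc n) = ℚₚ.+-mono-≤ (psum-≤ f≤g n) (f≤g n)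

psum-cong : ∀ {f g} → (∀ i → f i ≡ g i) → ∀ n → psum f n ≡ psum g n
psum-cong f≡g zero    = refl
psum-cong f≡g (suc n) = cong₂ ℚ._+_ (psum-cong f≡g n) (f≡g n)

psum-extend : ∀ {f} → (∀ i → 0ℚ ℚ.≤ f i) → ∀ {m n} → m ℕ.≤ n → psum f m ℚ.≤ psum f n
psum-extend {f} 0≤f {n = n} ℕ.z≤n = subst (ℚ._≤ psum f n) (psum-zero n) (psum-≤ 0≤f n)
  where
  psum-zero : ∀ n → psum (λ _ → 0ℚ) n ≡ 0ℚ
  psum-zero zero    = refl
  psum-zero (suc n) = trans (ℚₚ.+-identityʳ _) (psum-zero n)
psum-extend {f} 0≤f (ℕ.s≤s {m} {n} m≤n) = subst₂ ℚ._≤_ (sym (psum-front f m)) (sym (psum-front f n))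
  (ℚₚ.+-monoʳ-≤ (f 0) (psum-extend (0≤f ∘ suc) m≤n))

psum-* : ∀ c f n → psum (λ i → c ℚ.* f i) n ≡ c ℚ.* psum f n
psum-* c f zero    = sym (ℚₚ.*-zeroʳ c)
psum-* c f (suc n) = trans (cong (ℚ._+ c ℚ.* f n) (psum-* c f n))
  (sym (ℚₚ.*-distribˡ-+ c (psum f n) (f n)))

psum-+ : ∀ f g n → psum (λ i → f i ℚ.+ g i) n ≡ psum f n ℚ.+ psum g n
psum-+ f g zero    = refl
psum-+ f g (suc n) = trans (cong (ℚ._+ (f n ℚ.+ g n)) (psum-+ f g n))
  (solve 4 (λ s t u v → s :+ t :+ (u :+ v) := s :+ u :+ (t :+ v)) refl
    (psum f n) (psum g n) (f n) (g n))

-- A budget of positive errors, one for each interval of a cover, with all partial sums at most `ε`.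
geometric : ℚ → ℕ → ℚ
geometric ε i = ε ℚ.* ½^ (suc i)

geometric-pos : ∀ {ε} → 0ℚ ℚ.< ε → ∀ i → 0ℚ ℚ.< geometric ε i
geometric-pos 0<ε i = *-pos 0<ε (0<½^ (suc i))

psum-geometric : ∀ ε n → ε ℚ.- psum (geometric ε) n ≡ ε ℚ.* ½^ n
psum-geometric ε zero    = solve 1 (λ e → e :- con 0ℚ := e :* con 1ℚ) refl ε
psum-geometric ε (suc n) = trans
  (solve 3 (λ e s h → e :- (s :+ e :* (con ½ :* h)) := (e :- s) :- e :* (con ½ :* h)) refl
    ε (psum (geometric ε) n) (½^ n))
  (trans (cong (ℚ._- ε ℚ.* (½ ℚ.* ½^ n)) (psum-geometric ε n))
    (solve 2 (λ e h → e :* h :- e :* (con ½ :* h) := e :* (con ½ :* h)) refl ε (½^ n)))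

psum-geometric-≤ : ∀ {ε} → 0ℚ ℚ.< ε → ∀ n → psum (geometric ε) n ℚ.≤ ε
psum-geometric-≤ {ε} 0<ε n =
  ≤-gap (ℚₚ.<⇒≤ (*-pos 0<ε (0<½^ n))) (psum-geometric ε n)

eighth : ℚ → ℚ
eighth ε = ½ ℚ.* (½ ℚ.* (½ ℚ.* ε))

eighth-pos : ∀ {ε} → 0ℚ ℚ.< ε → 0ℚ ℚ.< eighth ε
eighth-pos 0<ε = half-pos (half-pos (half-pos 0<ε))

ι : ℚ → ℝ
ι q = mkℝ (λ _ → q) (const-cauchy q)

p≤∣p∣ : ∀ p → p ℚ.≤ ∣ p ∣
p≤∣p∣ p with ℚₚ.∣p∣≡p∨∣p∣≡-p p
... | inj₁ eq = ℚₚ.≤-reflexive (sym eq)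
... | inj₂ eq = ≤-gap (ℚₚ.0≤∣p∣ p ⊕ ℚₚ.0≤∣p∣ p) (cong (∣ p ∣ ℚ.+_) (sym eq))

distance-≤ : ∀ {p q δ} → ∣ p ℚ.- q ∣ ℚ.< δ → p ℚ.≤ q ℚ.+ δ
distance-≤ {p} {q} {δ} h = ≤-gap (gap (ℚₚ.≤-trans (p≤∣p∣ (p ℚ.- q)) (ℚₚ.<⇒≤ h)))
  (solve 3 (λ p q d → q :+ d :- p := d :- (p :- q)) refl p q δ)

∣-∣-swap : ∀ p q → ∣ p ℚ.- q ∣ ≡ ∣ q ℚ.- p ∣
∣-∣-swap p q = trans (sym (ℚₚ.∣-p∣≡∣p∣ (p ℚ.- q)))
  (cong ∣_∣ (solve 2 (λ p q → :- (p :- q) := q :- p) refl p q))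

-- Two one-sided bounds instead of an absolute value, so that each can be passed to `gap`.
Near : ℝ → ℚ → ℚ → Set
Near x q δ = Eventually λ n → seq x n ℚ.≤ q ℚ.+ δ × q ℚ.≤ seq x n ℚ.+ δ

approximate : ∀ x {δ} → 0ℚ ℚ.< δ → ∃[ q ] Near x q δ
approximate x {δ} 0<δ with N , h ← cauchy x δ 0<δ = seq x N , N , λ n N≤n →
  distance-≤ (h n N N≤n ℕₚ.≤-refl) , distance-≤ (h N n ℕₚ.≤-refl N≤n)

8*eighth : ∀ ε → fromℕ 8 ℚ.* eighth ε ≡ ε
8*eighth = solve 1 (λ e → con (fromℕ 8) :* (con ½ :* (con ½ :* (con ½ :* e))) := e) refl

infix 8 _·0≤_
_·0≤_ : ∀ k {ε} → 0ℚ ℚ.< ε → 0ℚ ℚ.≤ fromℕ k ℚ.* ε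
k ·0≤ 0<ε = 0≤fromℕ k ⊛ ℚₚ.<⇒≤ 0<ε

-- Cutting the tolerance into eight once suffices for the estimates that follow: each spends at most
-- eight copies of `ε`, and `·0≤` accounts for the copies left over.
≤-eighth : ∀ x y → (∀ ε → 0ℚ ℚ.< ε →
  Eventually λ n → seq x n ℚ.≤ seq y n ℚ.+ fromℕ 8 ℚ.* ε) → x ≤ y
≤-eighth x y h ε 0<ε = ev-map
  (λ n → subst (λ c → seq x n ℚ.≤ seq y n ℚ.+ c) (8*eighth ε)) (h (eighth ε) (eighth-pos 0<ε))

≤-trans : ∀ {x y z} → x ≤ y → y ≤ z → x ≤ z
≤-trans {x} {y} {z} x≤y y≤z = ≤-eighth x z λ ε 0<ε → ev-zip
  (λ n u v → ≤-gap (gap u ⊕ gap v ⊕ 6 ·0≤ 0<ε)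
    (solve 4 (λ a b c e → c :+ con (fromℕ 8) :* e :- a :=
      (b :+ e :- a) :+ (c :+ e :- b) :+ con (fromℕ 6) :* e) refl
      (seq x n) (seq y n) (seq z n) ε))
  (x≤y ε 0<ε) (y≤z ε 0<ε)

ι-mono : ∀ {p q} → p ℚ.≤ q → ι p ≤ ι q
ι-mono {p} {q} p≤q ε 0<ε = 0 , λ _ _ → ≤-gap (gap p≤q ⊕ ℚₚ.<⇒≤ 0<ε)
  (solve 3 (λ p q e → q :+ e :- p := (q :- p) :+ e) refl p q ε)

<⇒≱ : ∀ {p q} → p ℚ.< q → ¬ q ℚ.≤ p
<⇒≱ p<q q≤p = ℚₚ.<-irrefl refl (ℚₚ.<-≤-trans p<q q≤p)

ι-reflects-≤ : ∀ {p q} → ι p ≤ ι q → p ℚ.≤ q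
ι-reflects-≤ {p} {q} h with p ℚₚ.≤? q
... | yes p≤q = p≤q
... | no  p≰q = ⊥-elim (<⇒≱ (half< 0<p-q)
  (≤-gap (gap (ev-const (h (½ ℚ.* (p ℚ.- q)) (half-pos 0<p-q))))
    (solve 2 (λ p q → con ½ :* (p :- q) :- (p :- q) := q :+ con ½ :* (p :- q) :- p) refl p q)))
  where
  0<p-q : 0ℚ ℚ.< p ℚ.- q
  0<p-q = subst (ℚ._< p ℚ.- q) (ℚₚ.+-inverseʳ q) (ℚₚ.+-monoˡ-< (ℚ.- q) (ℚₚ.≰⇒> p≰q))

≤∞-trans : ∀ {p q r} → p ≤∞ q → q ≤∞ r → p ≤∞ r
≤∞-trans = ≤⁺-trans (λ {x} {y} {z} → ≤-trans {x} {y} {z})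

near-≤ : ∀ x q δ → Near x q δ → x ≤ ι (q ℚ.+ δ)
near-≤ x q δ near ε 0<ε = ev-map (λ n (u , _) → ≤-gap (gap u ⊕ ℚₚ.<⇒≤ 0<ε)
  (solve 3 (λ x q e → q :+ e :- x := (q :- x) :+ e) refl (seq x n) (q ℚ.+ δ) ε)) near

module _ (em : ExcludedMiddle 0ℓ) where

  -- Bisection keeps the left endpoint outside and the right endpoint inside the up-set `U` of
  -- rationals that bound some member of `P` from above. The last component records that the infimum
  -- is approached by such rationals, from which short covers are later extracted.
  infimum : (P : Pred ℝ∞ 0ℓ) → (∀ p → P p → [ 0ℝ ] ≤∞ p) → ∀ x → P [ x ] →
    ∃[ y ] (IsInf P [ y ] × (∀ ε → 0ℚ ℚ.< ε → ∃[ q ]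
      ((Eventually λ n → q ℚ.≤ seq y n ℚ.+ ε) × ∃[ p ] (P p × p ≤∞ [ ι q ]))))
  infimum P 0≤P x Px = infimum-of (bisect R ordered halve (¬U-1 , proj₂ start))
    where
    U : ℚ → Set
    U q = ∃[ p ] (P p × p ≤∞ [ ι q ])

    U-up : ∀ {q r} → q ℚ.≤ r → U q → U r
    U-up q≤r (p , Pp , p≤q) = p , Pp , ≤∞-trans p≤q [ ι-mono q≤r ]

    R : ℚ → ℚ → Set
    R p q = ¬ U p × U q

    ordered : ∀ {p q} → R p q → p ℚ.≤ q
    ordered {p} {q} (¬Up , Uq) with ℚₚ.≤-total p q
    ... | inj₁ p≤q = p≤q
    ... | inj₂ q≤p = ⊥-elim (¬Up (U-up q≤p Uq))

    halve : ∀ {p q} → R p q → R p (midpoint p q) ⊎ R (midpoint p q) q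
    halve {p} {q} (¬Up , Uq) with em {U (midpoint p q)}
    ... | yes Um = inj₁ (¬Up , Um)
    ... | no ¬Um = inj₂ (¬Um , Uq)

    -- The start lies strictly below 0, since 0 itself may belong to `U`.
    ¬U-1 : ¬ U (ℚ.- 1ℚ)
    ¬U-1 (p , Pp , p≤-1) = <⇒≱ (ℚₚ.negative⁻¹ (ℚ.- 1ℚ))
      (ι-reflects-≤ ([≤]-injective (≤∞-trans (0≤P p Pp) p≤-1)))

    start : ∃[ q ] U q
    start = bound (approximate x (ℚₚ.positive⁻¹ 1ℚ))
      where
      bound : ∃[ q ] Near x q 1ℚ → ∃[ q ] U q
      bound (q , near) = q ℚ.+ 1ℚ , [ x ] , Px , [ near-≤ x q 1ℚ near ]

    infimum-of : Shrinking R →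
      ∃[ y ] (IsInf P [ y ] × (∀ ε → 0ℚ ℚ.< ε → ∃[ q ]
        ((Eventually λ n → q ℚ.≤ seq y n ℚ.+ ε) × U q)))
    infimum-of (y , limit) = y , (lower-bound , greatest) , attained
      where
      lower-bound : ∀ p → P p → [ y ] ≤∞ p
      lower-bound ⊤⁺    Pp = _ ≤⊤⁺
      lower-bound [ z ] Pz = [ ≤-eighth y z below ]
        where
        below : ∀ ε → 0ℚ ℚ.< ε → Eventually λ n → seq y n ℚ.≤ seq z n ℚ.+ fromℕ 8 ℚ.* ε
        below ε 0<ε = let a , b , (¬Ua , _) , b≤a+ε , ev = limit ε 0<ε
                          c , near = approximate z 0<ε
                      in below′ ε 0<ε a b c b≤a+ε
                           (ordered (¬Ua , [ z ] , Pz , [ near-≤ z c ε near ])) ev near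
         where
         below′ : ∀ ε → 0ℚ ℚ.< ε → ∀ a b c → b ℚ.≤ a ℚ.+ ε → a ℚ.≤ c ℚ.+ ε →
           (Eventually λ n → a ℚ.≤ seq y n × seq y n ℚ.≤ b) → Near z c ε →
           Eventually λ n → seq y n ℚ.≤ seq z n ℚ.+ fromℕ 8 ℚ.* ε
         below′ ε 0<ε a b c b≤a+ε a≤c+ε = ev-zip (λ n (_ , yn≤b) (_ , c≤zn+ε) →
            ≤-gap (gap yn≤b ⊕ gap b≤a+ε ⊕ gap a≤c+ε ⊕ gap c≤zn+ε ⊕ 5 ·0≤ 0<ε)
            (solve 6 (λ y a b c z e → z :+ con (fromℕ 8) :* e :- y :=
              (b :- y) :+ (a :+ e :- b) :+ (c :+ e :- a) :+ (z :+ e :- c) :+ con (fromℕ 5) :* e) refl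
              (seq y n) a b c (seq z n) ε))

      greatest : ∀ l → (∀ p → P p → l ≤∞ p) → l ≤∞ [ y ]
      greatest ⊤⁺    h with () ← h [ x ] Px
      greatest [ z ] h = [ ≤-eighth z y above ]
        where
        above : ∀ ε → 0ℚ ℚ.< ε → Eventually λ n → seq z n ℚ.≤ seq y n ℚ.+ fromℕ 8 ℚ.* ε
        above ε 0<ε = let a , b , (_ , p , Pp , p≤b) , b≤a+ε , ev = limit ε 0<ε
                      in above′ ε 0<ε a b b≤a+ε ([≤]-injective (≤∞-trans (h p Pp) p≤b) ε 0<ε) ev
         where
         above′ : ∀ ε → 0ℚ ℚ.< ε → ∀ a b → b ℚ.≤ a ℚ.+ ε →
           (Eventually λ n → seq z n ℚ.≤ b ℚ.+ ε) →
           (Eventually λ n → a ℚ.≤ seq y n × seq y n ℚ.≤ b) →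
           Eventually λ n → seq z n ℚ.≤ seq y n ℚ.+ fromℕ 8 ℚ.* ε
         above′ ε 0<ε a b b≤a+ε = ev-zip (λ n zn≤b+ε (a≤yn , _) →
            ≤-gap (gap zn≤b+ε ⊕ gap b≤a+ε ⊕ gap a≤yn ⊕ 6 ·0≤ 0<ε)
              (solve 5 (λ y a b z e → y :+ con (fromℕ 8) :* e :- z :=
                (b :+ e :- z) :+ (a :+ e :- b) :+ (y :- a) :+ con (fromℕ 6) :* e) refl
                (seq y n) a b (seq z n) ε))

      attained : ∀ ε → 0ℚ ℚ.< ε → ∃[ q ] ((Eventually λ n → q ℚ.≤ seq y n ℚ.+ ε) × U q)
      attained ε 0<ε with a , b , (_ , Ub) , b≤a+ε , ev ← limit ε 0<ε =
        b , ev-map (λ n (a≤yn , _) → ≤-gap (gap b≤a+ε ⊕ gap a≤yn)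
          (solve 4 (λ y a b e → y :+ e :- b := (a :+ e :- b) :+ (y :- a)) refl
            (seq y n) a b ε)) ev , Ub

-- Covers by rational intervals

-- A rational bound on the partial sums replaces the sum of the lengths: no supremum has to exist,
-- the bound can be relaxed at will, and endpoints can be compared decidably.
record RationalCover (E : Pred ℝ 0ℓ) (s : ℚ) : Set where
  field
    lower upper : ℕ → ℚ
    ordered     : ∀ i → lower i ℚ.≤ upper i
    total       : ∀ n → psum (λ i → upper i ℚ.- lower i) n ℚ.≤ s
    covers      : ∀ x → E x → ∃[ i ] (ι (lower i) < x × x < ι (upper i))

open RationalCover

cover-⊆ : ∀ {E F s t} → (∀ x → F x → E x) → s ℚ.≤ t → RationalCover E s → RationalCover F t
cover-⊆ F⊆E s≤t c = record
  { lower = lower c ; upper = upper c ; ordered = ordered c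
  ; total = λ n → ℚₚ.≤-trans (total c n) s≤t
  ; covers = λ x Fx → covers c x (F⊆E x Fx) }

≤-<-trans : ∀ {x y z} → x ≤ y → y < z → x < z
≤-<-trans {x} {y} {z} x≤y (ε , 0<ε , ev) = ½ ℚ.* ε , half-pos 0<ε , ev-zip
  (λ n u v → ≤-gap (gap u ⊕ gap v) (solve 4 (λ x y z e →
    z :- (x :+ con ½ :* e) := (y :+ con ½ :* e :- x) :+ (z :- (y :+ e))) refl
    (seq x n) (seq y n) (seq z n) ε))
  (x≤y (½ ℚ.* ε) (half-pos 0<ε)) ev

<-≤-trans : ∀ {x y z} → x < y → y ≤ z → x < z
<-≤-trans {x} {y} {z} (ε , 0<ε , ev) y≤z = ½ ℚ.* ε , half-pos 0<ε , ev-zip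
  (λ n u v → ≤-gap (gap u ⊕ gap v) (solve 4 (λ x y z e →
    z :- (x :+ con ½ :* e) := (z :+ con ½ :* e :- y) :+ (y :- (x :+ e))) refl
    (seq x n) (seq y n) (seq z n) ε))
  (y≤z (½ ℚ.* ε) (half-pos 0<ε)) ev

near-≥ : ∀ x q δ → Near x q δ → ι (q ℚ.- δ) ≤ x
near-≥ x q δ near ε 0<ε = ev-map (λ n (_ , v) → ≤-gap (gap v ⊕ ℚₚ.<⇒≤ 0<ε)
  (solve 4 (λ x q d e → x :+ e :- (q :- d) := (x :+ d :- q) :+ e) refl (seq x n) q δ ε)) near

cover-length-nonneg : ∀ {E} p → CoverLength E p → [ 0ℝ ] ≤∞ p
cover-length-nonneg p (_ , _ , bound , _) = bound [ 0ℝ ] (0 , refl)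

module _ (em : ExcludedMiddle 0ℓ) where

  -- A `CoverLength` needs the exact sum of the series. It is obtained as the infimum of the
  -- rational upper bounds of the partial sums; the empty partial sum shows that these bounds are
  -- nonnegative.
  rational-cover-length : ∀ {E s} → RationalCover E s → ∃[ y ] (CoverLength E [ y ] × y ≤ ι s)
  rational-cover-length {E} {s} c =
    let y , isInf , _ = infimum em P (partial-≤ 0) (ι s) (s , refl , total c)
    in y , (intervals , covering , sup y isInf) ,
       [≤]-injective (proj₁ isInf [ ι s ] (s , refl , total c))
    where
    f : ℕ → ℚ
    f i = upper c i ℚ.- lower c i

    intervals : ℕ → Interval
    intervals i = record
      { left = ι (lower c i) ; right = ι (upper c i) ; left≤right = ι-mono (ordered c i) }

    covering : E ⊆ ⋃ ℕ (λ n → Interior (intervals n))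
    covering {x} Ex = covers c x Ex

    a : ℕ → ℝ
    a i = len (intervals i)

    partial : ∀ n m → seq (partialSum a n) m ≡ psum f n
    partial zero    m = refl
    partial (suc n) m = cong (ℚ._+ f n) (partial n m)

    U : ℚ → Set
    U q = ∀ n → psum f n ℚ.≤ q

    P : Pred ℝ∞ 0ℓ
    P p = ∃[ q ] (p ≡ [ ι q ] × U q)

    partial-≤ : ∀ n p → P p → [ partialSum a n ] ≤∞ p
    partial-≤ n _ (q , refl , Uq) = [ (λ ε 0<ε → 0 , λ m _ →
      ≤-gap (gap (Uq n) ⊕ ℚₚ.<⇒≤ 0<ε)
        (trans (cong (λ t → q ℚ.+ ε ℚ.- t) (partial n m))
          (solve 3 (λ q e s → q :+ e :- s := (q :- s) :+ e) refl q ε (psum f n)))) ]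

    ≤-partial : ∀ {n z} → partialSum a n ≤ z → ι (psum f n) ≤ z
    ≤-partial {n} {z} h ε 0<ε = ev-map (λ m → subst (ℚ._≤ seq z m ℚ.+ ε) (partial n m)) (h ε 0<ε)

    sup : ∀ y → IsInf P [ y ] → HasSum a [ y ]
    sup y (below , greatest) = upper-bound , least
      where
      upper-bound : ∀ p → ∃[ n ] p ≡ [ partialSum a n ] → p ≤∞ [ y ]
      upper-bound _ (n , refl) = greatest [ partialSum a n ] (partial-≤ n)

      least : ∀ u → (∀ p → ∃[ n ] p ≡ [ partialSum a n ] → p ≤∞ u) → [ y ] ≤∞ u
      least ⊤⁺    h = _ ≤⊤⁺
      least [ z ] h = [ ≤-eighth y z (λ ε 0<ε → let q , near = approximate z 0<ε in
        bound ε 0<ε q near) ]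
        where
        bound : ∀ ε → 0ℚ ℚ.< ε → ∀ q → Near z q ε →
          Eventually λ n → seq y n ℚ.≤ seq z n ℚ.+ fromℕ 8 ℚ.* ε
        bound ε 0<ε q near = ev-zip (λ n u (_ , v) → ≤-gap (gap u ⊕ gap v ⊕ 5 ·0≤ 0<ε)
          (solve 4 (λ y z q e → z :+ con (fromℕ 8) :* e :- y :=
            (q :+ e :+ e :- y) :+ (z :+ e :- q) :+ con (fromℕ 5) :* e) refl
            (seq y n) (seq z n) q ε))
          ([≤]-injective (below [ ι (q ℚ.+ ε) ] (q ℚ.+ ε , refl , λ n →
            ι-reflects-≤ (≤-trans {ι (psum f n)} {z} {ι (q ℚ.+ ε)}
              (≤-partial {n} {z} ([≤]-injective (h _ (n , refl)))) (near-≤ z q ε near)))) ε 0<ε)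
          near

+-mono-slack : ∀ a b c d e f → e ℚ.≤ a ℚ.+ c → f ℚ.≤ b ℚ.+ d →
  e ℚ.+ f ℚ.≤ a ℚ.+ b ℚ.+ (c ℚ.+ d)
+-mono-slack a b c d e f u v = ≤-gap (gap u ⊕ gap v)
  (solve 6 (λ a b c d e f → a :+ b :+ (c :+ d) :- (e :+ f) := (a :+ c :- e) :+ (b :+ d :- f))
    refl a b c d e f)

module _ (I : ℕ → Interval) {ε} (0<ε : 0ℚ ℚ.< ε) where

  private
    γ δ : ℕ → ℚ
    -- Half of `ε` is spread over the intervals; the other half absorbs the tolerance in the bound
    -- on the real partial sums.
    γ i = geometric (½ ℚ.* ε) i
    δ i = eighth (γ i)

    0<δ : ∀ i → 0ℚ ℚ.< δ i
    0<δ i = eighth-pos (geometric-pos (half-pos 0<ε) i)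

    L R : ℕ → ℚ
    L i = proj₁ (approximate (left (I i)) (0<δ i))
    R i = proj₁ (approximate (right (I i)) (0<δ i))

    near-L : ∀ i → Near (left (I i)) (L i) (δ i)
    near-L i = proj₂ (approximate (left (I i)) (0<δ i))

    near-R : ∀ i → Near (right (I i)) (R i) (δ i)
    near-R i = proj₂ (approximate (right (I i)) (0<δ i))

  -- One `δ` at each end covers the approximation error. The second one on the right pays for
  -- `left ≤ right`, which yields a rational inequality only up to an error, and so keeps the
  -- endpoints ordered.
  widened-lower widened-upper : ℕ → ℚ
  widened-lower i = L i ℚ.- δ i
  widened-upper i = R i ℚ.+ (δ i ℚ.+ δ i)

  widened-lower-≤ : ∀ i → ι (widened-lower i) ≤ left (I i)
  widened-lower-≤ i = near-≥ (left (I i)) (L i) (δ i) (near-L i)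

  ≤-widened-upper : ∀ i → right (I i) ≤ ι (widened-upper i)
  ≤-widened-upper i = ≤-trans {right (I i)} {ι (R i ℚ.+ δ i)} {ι (widened-upper i)}
    (near-≤ (right (I i)) (R i) (δ i) (near-R i))
    (ι-mono (ℚₚ.+-monoʳ-≤ (R i) (≤-gap (ℚₚ.<⇒≤ (0<δ i))
      (solve 1 (λ d → d :+ d :- d := d) refl (δ i)))))

  widened-ordered : ∀ i → widened-lower i ℚ.≤ widened-upper i
  widened-ordered i = go (L i) (R i) (δ i) (left (I i)) (right (I i)) (near-L i) (near-R i)
    (left≤right (I i) (δ i) (0<δ i))
    where
    go : ∀ l r d x y → Near x l d → Near y r d →
      (Eventually λ n → seq x n ℚ.≤ seq y n ℚ.+ d) → l ℚ.- d ℚ.≤ r ℚ.+ (d ℚ.+ d)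
    go l r d x y nx ny x≤y = ev-const (ev-zip (λ n (u , v) w → ≤-gap (gap u ⊕ gap v ⊕ gap w)
      (solve 5 (λ l r d x y → r :+ (d :+ d) :- (l :- d) := (r :+ d :- y) :+ (x :+ d :- l) :+ (y :+ d :- x))
        refl l r d (seq x n) (seq y n)))
      (ev-zip (λ n (u , _) (_ , v) → u , v) ny nx) x≤y)

  widened-length : ∀ i → Eventually λ n →
    widened-upper i ℚ.- widened-lower i ℚ.≤ seq (len (I i)) n ℚ.+ γ i
  widened-length i = ev-map
    (λ n → subst (λ c → widened-upper i ℚ.- widened-lower i ℚ.≤ seq (len (I i)) n ℚ.+ c) (8*eighth (γ i)))
    (go (L i) (R i) (δ i) (left (I i)) (right (I i)) (0<δ i) (near-L i) (near-R i))
    where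
    go : ∀ l r d x y → 0ℚ ℚ.< d → Near x l d → Near y r d → Eventually λ n →
      r ℚ.+ (d ℚ.+ d) ℚ.- (l ℚ.- d) ℚ.≤ seq y n ℚ.- seq x n ℚ.+ fromℕ 8 ℚ.* d
    go l r d x y 0<d = ev-zip (λ n (u , _) (_ , v) → ≤-gap (gap u ⊕ gap v ⊕ 3 ·0≤ 0<d)
      (solve 5 (λ l r d x y → y :- x :+ con (fromℕ 8) :* d :- (r :+ (d :+ d) :- (l :- d)) :=
          (l :+ d :- x) :+ (y :+ d :- r) :+ con (fromℕ 3) :* d)
        refl l r d (seq x n) (seq y n)))

  widened-total : ∀ {q} → (∀ n → partialSum (λ i → len (I i)) n ≤ ι q) →
    ∀ n → psum (λ i → widened-upper i ℚ.- widened-lower i) n ℚ.≤ q ℚ.+ ε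
  widened-total {q} bound n = go (partialSum (λ i → len (I i)) n) (partial n)
    (psum-geometric-≤ (half-pos 0<ε) n) (bound n (½ ℚ.* ε) (half-pos 0<ε))
    where
    w : ℕ → ℚ
    w i = widened-upper i ℚ.- widened-lower i

    partial : ∀ n → Eventually λ m → psum w n ℚ.≤ seq (partialSum (λ i → len (I i)) n) m ℚ.+ psum γ n
    partial zero    = 0 , λ _ _ → ℚₚ.≤-refl
    partial (suc n) = ev-zip
      (λ m → +-mono-slack (seq (partialSum (λ i → len (I i)) n) m) (seq (len (I n)) m)
        (psum γ n) (γ n) (psum w n) (w n))
      (partial n) (widened-length n)

    go : ∀ {s t} x → (Eventually λ m → s ℚ.≤ seq x m ℚ.+ t) → t ℚ.≤ ½ ℚ.* ε →
      (Eventually λ m → seq x m ℚ.≤ q ℚ.+ ½ ℚ.* ε) → s ℚ.≤ q ℚ.+ ε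
    go {s} {t} x u t≤ v = ev-const (ev-zip (λ m u v → ≤-gap (gap u ⊕ gap t≤ ⊕ gap v)
      (solve 5 (λ s t x q e → q :+ e :- s := (x :+ t :- s) :+ (con ½ :* e :- t) :+ (q :+ con ½ :* e :- x))
        refl s t (seq x m) q ε)) u v)

rational-cover-from-length : ∀ {E p q ε} → CoverLength E p → p ≤∞ [ ι q ] → 0ℚ ℚ.< ε →
  RationalCover E (q ℚ.+ ε)
rational-cover-from-length {q = q} (I , E⊆I , bound , _) p≤q 0<ε = record
  { lower   = widened-lower I 0<ε
  ; upper   = widened-upper I 0<ε
  ; ordered = widened-ordered I 0<ε
  ; total   = widened-total I 0<ε {q} λ n → [≤]-injective (≤∞-trans (bound _ (n , refl)) p≤q)
  ; covers  = λ x Ex → let i , l<x , x<r = E⊆I Ex in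
      i , ≤-<-trans {ι (widened-lower I 0<ε i)} {left (I i)} {x} (widened-lower-≤ I 0<ε i) l<x
        , <-≤-trans {x} {right (I i)} {ι (widened-upper I 0<ε i)} x<r (≤-widened-upper I 0<ε i)
  }

-- Outer measures and Carathéodory's criterion in terms of rational covers

module _ (em : ExcludedMiddle 0ℓ) where

  Approximable : Pred ℝ 0ℓ → ℝ → Set
  Approximable E y = ∀ ε → 0ℚ ℚ.< ε →
    ∃[ q ] ((Eventually λ n → q ℚ.≤ seq y n ℚ.+ ε) × RationalCover E (q ℚ.+ ε))

  -- A cover of finite total supplies the finite member of `CoverLength E` from which the infimum
  -- can be bisected.
  outer-measure : ∀ {E s} → RationalCover E s →
    ∃[ y ] (OuterMeasure E [ y ] × y ≤ ι s × Approximable E y)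
  outer-measure {E} {s} c = from-cover (rational-cover-length em c)
    where
    from-infimum : ∀ x → CoverLength E [ x ] → x ≤ ι s →
      ∃[ y ] (IsInf (CoverLength E) [ y ] × (∀ ε → 0ℚ ℚ.< ε → ∃[ q ]
        ((Eventually λ n → q ℚ.≤ seq y n ℚ.+ ε) × ∃[ p ] (CoverLength E p × p ≤∞ [ ι q ])))) →
      ∃[ y ] (OuterMeasure E [ y ] × y ≤ ι s × Approximable E y)
    from-infimum x Ex x≤s (y , isInf , attained) =
      y , isInf , ≤-trans {y} {x} {ι s} ([≤]-injective (proj₁ isInf [ x ] Ex)) x≤s ,
      λ ε 0<ε → let q , q≤y , p , Ep , p≤q = attained ε 0<ε
                in q , q≤y , rational-cover-from-length Ep p≤q 0<ε

    from-cover : ∃[ y ] (CoverLength E [ y ] × y ≤ ι s) →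
      ∃[ y ] (OuterMeasure E [ y ] × y ≤ ι s × Approximable E y)
    from-cover (x , Ex , x≤s) =
      from-infimum x Ex x≤s (infimum em (CoverLength E) cover-length-nonneg x Ex)

  -- Carathéodory's criterion stated for covers: the outer measures of the two pieces add up to that
  -- of `E`, which is at most `s`, and each piece has covers with totals close to its outer measure.
  split : ∀ {A E s ε} → LebesgueMeasurable A → IsSubset E → RationalCover E s → 0ℚ ℚ.< ε →
    ∃[ s₁ ] ∃[ s₂ ] (RationalCover (E ∩ A) s₁ × RationalCover (E ∖ A) s₂ × s₁ ℚ.+ s₂ ℚ.≤ s ℚ.+ ε)
  split {A} {E} {s} {ε} measurable subset c 0<ε = combine
    (outer-measure c)
    (outer-measure (cover-⊆ (λ _ → proj₁) ℚₚ.≤-refl c))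
    (outer-measure (cover-⊆ (λ _ → proj₁) ℚₚ.≤-refl c))
    where
    finite : ∀ {x y} → [ x ] ≃∞ [ y ] → x ≃ y
    finite [ x≃y ] = x≃y

    bound : ∀ m m₁ m₂ q₁ q₂ η → 0ℚ ℚ.< η → m ≤ ι s → m ≃ m₁ + m₂ →
      (Eventually λ n → q₁ ℚ.≤ seq m₁ n ℚ.+ η) → (Eventually λ n → q₂ ℚ.≤ seq m₂ n ℚ.+ η) →
      q₁ ℚ.+ η ℚ.+ (q₂ ℚ.+ η) ℚ.≤ s ℚ.+ fromℕ 8 ℚ.* η
    bound m m₁ m₂ q₁ q₂ η 0<η m≤s eq q₁≤ q₂≤ = ev-const (ev-zip
      (λ n (u , v) (d , w) →
        ≤-gap (gap u ⊕ gap v ⊕ gap (distance-≤ {seq m₁ n ℚ.+ seq m₂ n} {seq m n} (swap n d)) ⊕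
            gap w ⊕ 2 ·0≤ 0<η)
        (solve 7 (λ a b c p q s e → s :+ con (fromℕ 8) :* e :- (p :+ e :+ (q :+ e)) :=
            (b :+ e :- p) :+ (c :+ e :- q) :+ (a :+ e :- (b :+ c)) :+ (s :+ e :- a) :+ con (fromℕ 2) :* e)
          refl (seq m n) (seq m₁ n) (seq m₂ n) q₁ q₂ s η))
      (ev-zip (λ n → _,_) q₁≤ q₂≤) (ev-zip (λ n → _,_) (eq η 0<η) (m≤s η 0<η)))
      where
      swap : ∀ n → ∣ seq m n ℚ.- (seq m₁ n ℚ.+ seq m₂ n) ∣ ℚ.< η →
        ∣ seq m₁ n ℚ.+ seq m₂ n ℚ.- seq m n ∣ ℚ.< η
      swap n = subst (ℚ._< η) (∣-∣-swap (seq m n) (seq m₁ n ℚ.+ seq m₂ n))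

    combine : ∃[ y ] (OuterMeasure E [ y ] × y ≤ ι s × Approximable E y) →
      ∃[ y ] (OuterMeasure (E ∩ A) [ y ] × y ≤ ι s × Approximable (E ∩ A) y) →
      ∃[ y ] (OuterMeasure (E ∖ A) [ y ] × y ≤ ι s × Approximable (E ∖ A) y) →
      ∃[ s₁ ] ∃[ s₂ ] (RationalCover (E ∩ A) s₁ × RationalCover (E ∖ A) s₂ × s₁ ℚ.+ s₂ ℚ.≤ s ℚ.+ ε)
    combine (m , isOuter , m≤s , _) (m₁ , isOuter₁ , _ , attained₁) (m₂ , isOuter₂ , _ , attained₂) =
      let q₁ , q₁≤ , c₁ = attained₁ (eighth ε) (eighth-pos 0<ε)
          q₂ , q₂≤ , c₂ = attained₂ (eighth ε) (eighth-pos 0<ε)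
      in q₁ ℚ.+ eighth ε , q₂ ℚ.+ eighth ε , c₁ , c₂ ,
         subst (λ e → q₁ ℚ.+ eighth ε ℚ.+ (q₂ ℚ.+ eighth ε) ℚ.≤ s ℚ.+ e) (8*eighth ε)
           (bound m m₁ m₂ q₁ q₂ (eighth ε) (eighth-pos 0<ε) m≤s
             (finite (measurable E subset [ m ] [ m₁ ] [ m₂ ] isOuter isOuter₁ isOuter₂)) q₁≤ q₂≤)

-- Countable unions and reflections of covers

-- Cantor's walk along the antidiagonals. As the orbit of a successor map, it lets partial sums be
-- followed one step at a time.
next : ℕ × ℕ → ℕ × ℕ
next (i , suc j) = suc i , j
next (i , zero)  = zero , suc i

walk : ℕ → ℕ × ℕ
walk zero    = zero , zero
walk (suc n) = next (walk n)

walk-along : ∀ i {j k n} → walk n ≡ (k , i ℕ.+ j) → ∃[ m ] walk m ≡ (i ℕ.+ k , j)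
walk-along zero        {n = n} eq = n , eq
walk-along (suc i) {j} {k} {n} eq with m , eq′ ← walk-along i {j} {suc k} {suc n} (cong next eq) =
  m , trans eq′ (cong (_, j) (ℕₚ.+-suc i k))

walk-start : ∀ d → ∃[ n ] walk n ≡ (zero , d)
walk-start zero    = zero , refl
walk-start (suc d) with n , eq ← walk-start d
  with m , eq′ ← walk-along d {zero} {zero} {n} (trans eq (cong (zero ,_) (sym (ℕₚ.+-identityʳ d)))) =
  suc m , trans (cong next eq′) (cong (λ e → zero , suc e) (ℕₚ.+-identityʳ d))

walk-surjective : ∀ i j → ∃[ n ] walk n ≡ (i , j)
walk-surjective i j with n , eq ← walk-start (i ℕ.+ j)
  with m , eq′ ← walk-along i {j} {zero} {n} eq =
  m , trans eq′ (cong (_, j) (ℕₚ.+-identityʳ i))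

-- The sum over the antidiagonals `i + j < d`, arranged by rows because the bounds are given for
-- rows.
triangle : ℕ → (ℕ → ℕ → ℚ) → ℚ
triangle zero    f = 0ℚ
triangle (suc d) f = psum (f 0) (suc d) ℚ.+ triangle d (f ∘ suc)

-- The sum of f over the points that the walk visits before (i , j), arranged by rows.
visited : ℕ → ℕ → (ℕ → ℕ → ℚ) → ℚ
visited zero    j f = triangle j f
visited (suc i) j f = psum (f 0) (suc (suc (i ℕ.+ j))) ℚ.+ visited i j (f ∘ suc)

visited-down : ∀ i j f → visited i (suc j) f ℚ.+ f i (suc j) ≡ visited (suc i) j f
visited-down zero j f =
  solve 3 (λ p t x → p :+ t :+ x := p :+ x :+ t) refl
    (psum (f 0) (suc j)) (triangle j (f ∘ suc)) (f 0 (suc j))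
visited-down (suc i) j f = trans
  (ℚₚ.+-assoc (psum (f 0) (suc (suc (i ℕ.+ suc j)))) (visited i (suc j) (f ∘ suc)) (f (suc i) (suc j)))
  (cong₂ ℚ._+_ (cong (λ k → psum (f 0) (suc (suc k))) (ℕₚ.+-suc i j)) (visited-down i j (f ∘ suc)))

visited-diagonal : ∀ i f → visited i zero f ℚ.+ f i zero ≡ triangle (suc i) f
visited-diagonal zero    f = sym (ℚₚ.+-identityʳ (0ℚ ℚ.+ f 0 0))
visited-diagonal (suc i) f = trans
  (ℚₚ.+-assoc (psum (f 0) (suc (suc (i ℕ.+ zero)))) (visited i zero (f ∘ suc)) (f (suc i) zero))
  (cong₂ ℚ._+_ (cong (λ k → psum (f 0) (suc (suc k))) (ℕₚ.+-identityʳ i)) (visited-diagonal i (f ∘ suc)))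

psum-walk : ∀ f n → psum (λ k → f (proj₁ (walk k)) (proj₂ (walk k))) n ≡
  visited (proj₁ (walk n)) (proj₂ (walk n)) f
psum-walk f zero    = refl
psum-walk f (suc n) = trans (cong (ℚ._+ f (proj₁ (walk n)) (proj₂ (walk n))) (psum-walk f n))
  (visited-next (walk n))
  where
  visited-next : ∀ v → visited (proj₁ v) (proj₂ v) f ℚ.+ f (proj₁ v) (proj₂ v) ≡
    visited (proj₁ (next v)) (proj₂ (next v)) f
  visited-next (i , suc j) = visited-down i j f
  visited-next (i , zero)  = visited-diagonal i f

triangle-≤ : ∀ d {f s} → (∀ i n → psum (f i) n ℚ.≤ s i) → triangle d f ℚ.≤ psum s d
triangle-≤ zero    h = ℚₚ.≤-refl
triangle-≤ (suc d) {f} {s} h = subst (triangle (suc d) f ℚ.≤_) (sym (psum-front s d))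
  (ℚₚ.+-mono-≤ (h 0 (suc d)) (triangle-≤ d (h ∘ suc)))

-- Before `(i , j)` the walk has met only the first `i + j` rows, each in an initial segment.
visited-≤ : ∀ i j {f s} → (∀ i n → psum (f i) n ℚ.≤ s i) → visited i j f ℚ.≤ psum s (i ℕ.+ j)
visited-≤ zero    j h = triangle-≤ j h
visited-≤ (suc i) j {f} {s} h = subst (visited (suc i) j f ℚ.≤_) (sym (psum-front s (i ℕ.+ j)))
  (ℚₚ.+-mono-≤ (h 0 (suc (suc (i ℕ.+ j)))) (visited-≤ i j (h ∘ suc)))

-- Countable subadditivity of the outer measure, with the two indices merged by `walk`.
cover-⋃ : ∀ {E : ℕ → Pred ℝ 0ℓ} {s S} → (∀ i → RationalCover (E i) (s i)) →
  (∀ n → psum s n ℚ.≤ S) → RationalCover (⋃ ℕ E) S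
cover-⋃ {E} {s} {S} c s≤S = record
  { lower   = λ k → lower (c (proj₁ (walk k))) (proj₂ (walk k))
  ; upper   = λ k → upper (c (proj₁ (walk k))) (proj₂ (walk k))
  ; ordered = λ k → ordered (c (proj₁ (walk k))) (proj₂ (walk k))
  ; total   = λ n → ℚₚ.≤-trans (ℚₚ.≤-reflexive (psum-walk f n))
      (ℚₚ.≤-trans (visited-≤ (proj₁ (walk n)) (proj₂ (walk n)) {f} {s} (λ i → total (c i)))
        (s≤S (proj₁ (walk n) ℕ.+ proj₂ (walk n))))
  ; covers  = λ x (i , Ex) → let j , l<x , x<u = covers (c i) x Ex
                                 k , eq = walk-surjective i j
      in k , subst (λ v → ι (lower (c (proj₁ v)) (proj₂ v)) < x) (sym eq) l<x
           , subst (λ v → x < ι (upper (c (proj₁ v)) (proj₂ v))) (sym eq) x<u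
  }
  where
  f : ℕ → ℕ → ℚ
  f i j = upper (c i) j ℚ.- lower (c i) j

Between : ℚ → ℚ → Pred ℝ 0ℓ
Between a b x = ι a < x × x < ι b

cover-interval : ∀ {a b} → a ℚ.≤ b → RationalCover (Between a b) (b ℚ.- a)
cover-interval {a} {b} a≤b = record
  { lower = pad a ; upper = pad b ; ordered = ordered′ ; total = total′
  ; covers = λ x x∈ → 0 , x∈ }
  where
  pad : ℚ → ℕ → ℚ
  pad q zero    = q
  -- A cover is an infinite sequence; degenerate intervals fill it without adding length.
  pad q (suc _) = 0ℚ

  ordered′ : ∀ i → pad a i ℚ.≤ pad b i
  ordered′ zero    = a≤b
  ordered′ (suc _) = ℚₚ.≤-refl

  total′ : ∀ n → psum (λ i → pad b i ℚ.- pad a i) n ℚ.≤ b ℚ.- a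
  total′ zero          = gap a≤b
  total′ (suc zero)    = ℚₚ.≤-reflexive (ℚₚ.+-identityˡ (b ℚ.- a))
  total′ (suc (suc n)) = ℚₚ.≤-trans (ℚₚ.≤-reflexive (ℚₚ.+-identityʳ _)) (total′ (suc n))

cover-empty : ∀ {E s} → (∀ x → ¬ E x) → 0ℚ ℚ.≤ s → RationalCover E s
cover-empty empty 0≤s = cover-⊆ (λ x Ex → ⊥-elim (empty x Ex)) 0≤s (cover-interval (ℚₚ.≤-refl {0ℚ}))

-- The centre of reflection is a real number, so each reflected interval uses its own rational
-- approximation `τ i` of `t` and grows by `δ i` at both ends; these losses sum to at most `ε`.
cover-reflect : ∀ {E s ε} t → 0ℚ ℚ.< ε → RationalCover E s → RationalCover (λ x → E (t - x)) (s ℚ.+ ε)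
cover-reflect {E} {s} {ε} t 0<ε c = record
  { lower   = λ i → τ i ℚ.- upper c i ℚ.- δ i
  ; upper   = λ i → τ i ℚ.- lower c i ℚ.+ δ i
  ; ordered = λ i → ≤-gap (gap (ordered c i) ⊕ (ℚₚ.<⇒≤ (0<δ i) ⊕ ℚₚ.<⇒≤ (0<δ i)))
      (difference (τ i) (lower c i) (upper c i) (δ i))
  ; total   = λ n → ℚₚ.≤-trans (psum-≤ (λ i → ℚₚ.≤-reflexive (trans
        (difference (τ i) (lower c i) (upper c i) (δ i))
        (cong (λ e → upper c i ℚ.- lower c i ℚ.+ e) (half+half (geometric ε i))))) n)
      (ℚₚ.≤-trans (ℚₚ.≤-reflexive (psum-+ (λ i → upper c i ℚ.- lower c i) (geometric ε) n))
        (ℚₚ.+-mono-≤ (total c n) (psum-geometric-≤ 0<ε n)))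
  ; covers  = λ x Ex → let i , below , above = covers c (t - x) Ex in
      i , reflect-upper x (τ i) (δ i) (upper c i) (near i) above
        , reflect-lower x (τ i) (δ i) (lower c i) (near i) below
  }
  where
  δ : ℕ → ℚ
  δ i = ½ ℚ.* geometric ε i

  0<δ : ∀ i → 0ℚ ℚ.< δ i
  0<δ i = half-pos (geometric-pos 0<ε i)

  τ : ℕ → ℚ
  τ i = proj₁ (approximate t (0<δ i))

  near : ∀ i → Near t (τ i) (δ i)
  near i = proj₂ (approximate t (0<δ i))

  difference : ∀ t l u d → (t ℚ.- l ℚ.+ d) ℚ.- (t ℚ.- u ℚ.- d) ≡ (u ℚ.- l) ℚ.+ (d ℚ.+ d)
  difference = solve 4 (λ t l u d → (t :- l :+ d) :- (t :- u :- d) := (u :- l) :+ (d :+ d)) refl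

  reflect-upper : ∀ x τ δ u → Near t τ δ → t - x < ι u → ι (τ ℚ.- u ℚ.- δ) < x
  reflect-upper x τ δ u near (η , 0<η , ev) = η , 0<η , ev-zip
    (λ n (_ , v) w → ≤-gap (gap v ⊕ gap w)
      (solve 6 (λ x s d u h t → x :- (s :- u :- d :+ h) := (t :+ d :- s) :+ (u :- (t :- x :+ h)))
        refl (seq x n) τ δ u η (seq t n))) near ev

  reflect-lower : ∀ x τ δ l → Near t τ δ → ι l < t - x → x < ι (τ ℚ.- l ℚ.+ δ)
  reflect-lower x τ δ l near (η , 0<η , ev) = η , 0<η , ev-zip
    (λ n (v , _) w → ≤-gap (gap v ⊕ gap w)
      (solve 6 (λ x s d l h t → s :- l :+ d :- (x :+ h) := (s :+ d :- t) :+ (t :- x :- (l :+ h)))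
        refl (seq x n) τ δ l η (seq t n))) near ev

-- The length of an interval is at most that of any cover of it

clamp : ℚ → ℚ → ℚ → ℚ
clamp l u x = (x ℚ.⊔ l) ℚ.⊓ u

clamp-mono : ∀ l u {x y} → x ℚ.≤ y → clamp l u x ℚ.≤ clamp l u y
clamp-mono l u x≤y = ℚₚ.⊓-monoˡ-≤ u (ℚₚ.⊔-monoˡ-≤ l x≤y)

clamp-variation : ∀ {l u} → l ℚ.≤ u → ∀ x y → clamp l u y ℚ.- clamp l u x ℚ.≤ u ℚ.- l
clamp-variation {l} {u} l≤u x y = ≤-gap
  (gap (ℚₚ.p⊓q≤q (y ℚ.⊔ l) u) ⊕ gap (ℚₚ.⊓-glb (ℚₚ.p≤q⊔p x l) l≤u))
  (solve 4 (λ l u a b → u :- l :- (b :- a) := (u :- b) :+ (a :- l)) refl l u (clamp l u x) (clamp l u y))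

clamp-inside : ∀ {l u x} → l ℚ.≤ x → x ℚ.≤ u → clamp l u x ≡ x
clamp-inside {l} {u} {x} l≤x x≤u =
  trans (cong (ℚ._⊓ u) (ℚₚ.p≥q⇒p⊔q≡p l≤x)) (ℚₚ.p≤q⇒p⊓q≡p x≤u)

module _ {E : Pred ℝ 0ℓ} {s : ℚ} (c : RationalCover E s) where

  -- For `p ≤ q` this is the length of the part of `[p , q]` inside the interval with index `i`. As
  -- a difference of clamps it telescopes under subdivision.
  variation : ℚ → ℚ → ℕ → ℚ
  variation p q i = clamp (lower c i) (upper c i) q ℚ.- clamp (lower c i) (upper c i) p

  0≤variation : ∀ {p q} → p ℚ.≤ q → ∀ i → 0ℚ ℚ.≤ variation p q i
  0≤variation p≤q i = gap (clamp-mono (lower c i) (upper c i) p≤q)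

  -- A finite form, additive in [p , q], of "finitely many of the intervals cover [p , q]".
  Filled : ℚ → ℚ → Set
  Filled p q = ∃[ n ] q ℚ.- p ℚ.≤ psum (variation p q) n

  filled-join : ∀ {p m q} → p ℚ.≤ m → m ℚ.≤ q → Filled p m → Filled m q → Filled p q
  filled-join {p} {m} {q} p≤m m≤q (j , u) (k , v) = j ℕ.⊔ k , ≤-gap
    (gap (ℚₚ.≤-trans u (psum-extend (0≤variation p≤m) (ℕₚ.m≤m⊔n j k))) ⊕
     gap (ℚₚ.≤-trans v (psum-extend (0≤variation m≤q) (ℕₚ.m≤n⊔m j k))))
    (trans (cong (ℚ._- (q ℚ.- p)) additive)
      (solve 5 (λ p m q a b → a :+ b :- (q :- p) := (a :- (m :- p)) :+ (b :- (q :- m))) refl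
        p m q (psum (variation p m) (j ℕ.⊔ k)) (psum (variation m q) (j ℕ.⊔ k))))
    where
    additive : psum (variation p q) (j ℕ.⊔ k) ≡
      psum (variation p m) (j ℕ.⊔ k) ℚ.+ psum (variation m q) (j ℕ.⊔ k)
    additive = trans
      (psum-cong (λ i → solve 3 (λ p m q → q :- p := (m :- p) :+ (q :- m)) refl
        (clamp (lower c i) (upper c i) p) (clamp (lower c i) (upper c i) m)
        (clamp (lower c i) (upper c i) q)) (j ℕ.⊔ k))
      (psum-+ (variation p m) (variation m q) (j ℕ.⊔ k))

  filled-inside : ∀ {p q} i → lower c i ℚ.≤ p → p ℚ.≤ q → q ℚ.≤ upper c i → Filled p q
  -- The last of the `suc i` terms already equals `q - p`; the earlier ones are nonnegative.
  filled-inside {p} {q} i l≤p p≤q q≤u = suc i , ≤-gap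
    (psum-extend {variation p q} (0≤variation p≤q) {0} {i} ℕ.z≤n)
    (trans (cong₂ (λ y x → psum (variation p q) i ℚ.+ (y ℚ.- x) ℚ.- (q ℚ.- p))
        (clamp-inside (ℚₚ.≤-trans l≤p p≤q) q≤u) (clamp-inside l≤p (ℚₚ.≤-trans p≤q q≤u)))
      (solve 2 (λ t w → t :+ w :- w := t) refl (psum (variation p q) i) (q ℚ.- p)))

  filled-≤ : ∀ {p q} → Filled p q → q ℚ.- p ℚ.≤ s
  filled-≤ {p} {q} (n , w) = ℚₚ.≤-trans w (ℚₚ.≤-trans
    (psum-≤ (λ i → clamp-variation (ordered c i) p q) n) (total c n))

  module _ (em : ExcludedMiddle 0ℓ) where

    -- Heine-Borel by bisection. If `[a , b]` is not `Filled`, unfilled halves shrink to a point `x`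
    -- of `[a , b]`. Some interval of the cover contains `x` with room on both sides, hence contains
    -- a late stage and fills it alone.
    length-≤-total : ∀ {a b} → a ℚ.≤ b → (∀ x → ι a ≤ x → x ≤ ι b → E x) → b ℚ.- a ℚ.≤ s
    length-≤-total {a} {b} a≤b contains with em {Filled a b}
    ... | yes filled = filled-≤ {a} {b} filled
    ... | no ¬filled = ⊥-elim (contradiction
      (bisect R (λ (_ , _ , p≤q , _) → p≤q) halve (ℚₚ.≤-refl , ℚₚ.≤-refl , a≤b , ¬filled)))
      where
      R : ℚ → ℚ → Set
      R p q = a ℚ.≤ p × q ℚ.≤ b × p ℚ.≤ q × ¬ Filled p q

      halve : ∀ {p q} → R p q → R p (midpoint p q) ⊎ R (midpoint p q) q
      halve {p} {q} (a≤p , q≤b , p≤q , ¬f) = go (midpoint p q)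
        (≤-gap (0≤½ ⊛ gap p≤q) (midpoint-gapˡ p q)) (≤-gap (0≤½ ⊛ gap p≤q) (midpoint-gapʳ p q))
        where
        go : ∀ m → p ℚ.≤ m → m ℚ.≤ q → R p m ⊎ R m q
        go m p≤m m≤q with em {Filled p m}
        ... | yes f = inj₂ (ℚₚ.≤-trans a≤p p≤m , q≤b , m≤q , λ g → ¬f (filled-join p≤m m≤q f g))
        ... | no ¬g = inj₁ (a≤p , ℚₚ.≤-trans m≤q q≤b , p≤m , ¬g)

      contradiction : ¬ Shrinking R
      contradiction (x , limit) = local (covers c x (contains x a≤x x≤b))
        where
        a≤x : ι a ≤ x
        a≤x ε 0<ε = let p , q , (a≤p , _) , _ , ev = limit ε 0<ε in
          ev-map (λ n (p≤x , _) → ≤-gap (gap a≤p ⊕ gap p≤x ⊕ ℚₚ.<⇒≤ 0<ε)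
            (solve 4 (λ a p x e → x :+ e :- a := (p :- a) :+ (x :- p) :+ e) refl a p (seq x n) ε)) ev

        x≤b : x ≤ ι b
        x≤b ε 0<ε = let p , q , (_ , q≤b , _) , _ , ev = limit ε 0<ε in
          ev-map (λ n (_ , x≤q) → ≤-gap (gap q≤b ⊕ gap x≤q ⊕ ℚₚ.<⇒≤ 0<ε)
            (solve 4 (λ b q x e → b :+ e :- x := (b :- q) :+ (q :- x) :+ e) refl b q (seq x n) ε)) ev

        local : ¬ (∃[ i ] (ι (lower c i) < x × x < ι (upper c i)))
        local (i , (ε₁ , 0<ε₁ , below) , (ε₂ , 0<ε₂ , above)) =
          -- The margins of `x` inside the covering interval are `ε₁` and `ε₂`; a stage around `x`
          -- that is no wider than either cannot leave that interval.
          let p , q , (_ , _ , p≤q , ¬f) , w₁ , ev = limit (ε₁ ℚ.⊓ ε₂) (⊓-pos 0<ε₁ 0<ε₂)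
              l≤p , q≤u = squeeze p q (lower c i) (upper c i) ε₁ ε₂ w₁ below above ev
          in ¬f (filled-inside i l≤p p≤q q≤u)
          where
          ⊓-pos : ∀ {ε₁ ε₂} → 0ℚ ℚ.< ε₁ → 0ℚ ℚ.< ε₂ → 0ℚ ℚ.< ε₁ ℚ.⊓ ε₂
          ⊓-pos {ε₁} {ε₂} u v with ℚₚ.⊓-sel ε₁ ε₂
          ... | inj₁ eq = subst (0ℚ ℚ.<_) (sym eq) u
          ... | inj₂ eq = subst (0ℚ ℚ.<_) (sym eq) v

          squeeze : ∀ p q l u ε₁ ε₂ → q ℚ.≤ p ℚ.+ ε₁ ℚ.⊓ ε₂ →
            (Eventually λ n → l ℚ.+ ε₁ ℚ.≤ seq x n) → (Eventually λ n → seq x n ℚ.+ ε₂ ℚ.≤ u) →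
            (Eventually λ n → p ℚ.≤ seq x n × seq x n ℚ.≤ q) → l ℚ.≤ p × q ℚ.≤ u
          squeeze p q l u ε₁ ε₂ w below above ev =
            ev-const (ev-zip (λ n v (_ , x≤q) →
              ≤-gap (gap w ⊕ gap (ℚₚ.p⊓q≤p ε₁ ε₂) ⊕ gap v ⊕ gap x≤q)
                (solve 6 (λ p q l e m x →
                    p :- l := (p :+ m :- q) :+ (e :- m) :+ (x :- (l :+ e)) :+ (q :- x))
                  refl p q l ε₁ (ε₁ ℚ.⊓ ε₂) (seq x n))) below ev) ,
            ev-const (ev-zip (λ n v (p≤x , _) →
              ≤-gap (gap w ⊕ gap (ℚₚ.p⊓q≤q ε₁ ε₂) ⊕ gap v ⊕ gap p≤x)
                (solve 6 (λ p q u e m x →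
                    u :- q := (p :+ m :- q) :+ (e :- m) :+ (u :- (x :+ e)) :+ (x :- p))
                  refl p q u ε₂ (ε₁ ℚ.⊓ ε₂) (seq x n))) above ev)

-- Parts that are closed under addition

≃-pointwise : ∀ x y → (∀ n → seq x n ≡ seq y n) → x ≃ y
≃-pointwise x y eq ε 0<ε = 0 , λ n _ → subst (λ p → ∣ p ∣ ℚ.< ε)
  (trans (sym (ℚₚ.+-inverseʳ (seq y n))) (cong (ℚ._- seq y n) (sym (eq n)))) 0<ε

≃⇒≤ : ∀ {x y} → x ≃ y → x ≤ y
≃⇒≤ x≃y ε 0<ε = ev-map (λ n → distance-≤) (x≃y ε 0<ε)

≃-sym : ∀ {x y} → x ≃ y → y ≃ x
≃-sym {x} {y} x≃y ε 0<ε =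
  ev-map (λ n → subst (ℚ._< ε) (∣-∣-swap (seq x n) (seq y n))) (x≃y ε 0<ε)

Between-subset : ∀ a b → IsSubset (Between a b)
Between-subset a b {x} {y} x≃y (a<x , x<b) =
  <-≤-trans {ι a} {x} {y} a<x (≃⇒≤ {x} {y} x≃y) ,
  ≤-<-trans {y} {x} {ι b} (≃⇒≤ {y} {x} (≃-sym {x} {y} x≃y)) x<b

Between-empty : ∀ {a b} → b ℚ.≤ a → ∀ x → ¬ Between a b x
Between-empty {a} {b} b≤a x (a<x , (ε , 0<ε , x<b)) with η , 0<η , ev ← a<x =
  <⇒≱ 0<ε (ev-const (ev-zip (λ n u v → ≤-gap (gap u ⊕ gap v ⊕ gap b≤a ⊕ ℚₚ.<⇒≤ 0<η)
    (solve 5 (λ a b x e h → con 0ℚ :- e := (x :- (a :+ h)) :+ (b :- (x :+ e)) :+ (a :- b) :+ h)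
      refl a b (seq x n) ε η)) ev x<b))

Between-⊆ : ∀ {a b a′ b′} → a′ ℚ.≤ a → b ℚ.≤ b′ → ∀ x → Between a b x → Between a′ b′ x
Between-⊆ {a} {b} {a′} {b′} a′≤a b≤b′ x (a<x , x<b) =
  ≤-<-trans {ι a′} {ι a} {x} (ι-mono a′≤a) a<x , <-≤-trans {x} {ι b} {ι b′} x<b (ι-mono b≤b′)

Between-reflect : ∀ {a b η} t → Near t (a ℚ.+ b) η → ∀ x → Between a b x →
  Between (a ℚ.- η) (b ℚ.+ η) (t - x)
Between-reflect {a} {b} {η} t near x ((ε₁ , 0<ε₁ , a<x) , (ε₂ , 0<ε₂ , x<b)) =
  (ε₂ , 0<ε₂ , ev-zip (λ n (_ , u) v → ≤-gap (gap u ⊕ gap v)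
    (solve 6 (λ a b h t x e → t :- x :- (a :- h :+ e) := (t :+ h :- (a :+ b)) :+ (b :- (x :+ e)))
      refl a b η (seq t n) (seq x n) ε₂)) near x<b) ,
  (ε₁ , 0<ε₁ , ev-zip (λ n (u , _) v → ≤-gap (gap u ⊕ gap v)
    (solve 6 (λ a b h t x e → b :+ h :- (t :- x :+ e) := (a :+ b :+ h :- t) :+ (x :- (a :+ e)))
      refl a b η (seq t n) (seq x n) ε₁)) near a<x)

lower-em : ExcludedMiddle (lsuc 0ℓ) → ExcludedMiddle 0ℓ
lower-em em {P} = map′ lower lift (em {Lift (lsuc 0ℓ) P})

module _ {A : Pred ℝ 0ℓ} (em : ExcludedMiddle 0ℓ) (subset : IsSubset A)
  (+-closed : ∀ x y → x ∈ A → y ∈ A → x + y ∈ A) (measurable : LebesgueMeasurable A)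
  (outside : ∀ d η → 0ℚ ℚ.< η → ∃[ t ] (¬ A t × Near t d η)) where

  -- The interval has length `16 η`, its widening `E` has length `18 η`, and splitting costs another
  -- `η`. The cheaper of the two covers thus has total at most `19/2 η`; reflecting it, if it covers
  -- `E ∖ A`, adds `η`. The sum stays below `12 η`, which is 3/4 of `16 η`.
  cover-part : ∀ a η → 0ℚ ℚ.< η → let b = a ℚ.+ fromℕ 16 ℚ.* η in
    RationalCover (A ∩ Between a b) (fromℕ 12 ℚ.* η)
  cover-part a η 0<η = reflected (outside (a ℚ.+ b) η 0<η)
    where
    b : ℚ
    b = a ℚ.+ fromℕ 16 ℚ.* η

    E : Pred ℝ 0ℓ
    E = Between (a ℚ.- η) (b ℚ.+ η)

    bound : ∀ p q → p ℚ.+ q ℚ.≤ b ℚ.+ η ℚ.- (a ℚ.- η) ℚ.+ η → p ℚ.≤ q → p ℚ.+ η ℚ.≤ fromℕ 12 ℚ.* η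
    bound p q u v = ≤-gap (0≤½ ⊛ (gap u ⊕ gap v ⊕ 3 ·0≤ 0<η))
      (solve 4 (λ a e p q → con (fromℕ 12) :* e :- (p :+ e) := con ½ :*
          ((a :+ con (fromℕ 16) :* e :+ e :- (a :- e) :+ e :- (p :+ q)) :+ (q :- p) :+
            con (fromℕ 3) :* e))
        refl a η p q)

    a≤b : a ℚ.≤ b
    a≤b = ≤-gap (16 ·0≤ 0<η) (solve 2 (λ a w → a :+ w :- a := w) refl a (fromℕ 16 ℚ.* η))

    a-η≤a : ∀ a → a ℚ.- η ℚ.≤ a
    a-η≤a a = ≤-gap (ℚₚ.<⇒≤ 0<η) (solve 2 (λ a e → a :- (a :- e) := e) refl a η)

    b≤b+η : ∀ b → b ℚ.≤ b ℚ.+ η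
    b≤b+η b = ≤-gap (ℚₚ.<⇒≤ 0<η) (solve 2 (λ b e → b :+ e :- b := e) refl b η)

    choose : ∀ {t} → ¬ A t → Near t (a ℚ.+ b) η → ∃[ s₁ ] ∃[ s₂ ]
      (RationalCover (E ∩ A) s₁ × RationalCover (E ∖ A) s₂ ×
        s₁ ℚ.+ s₂ ℚ.≤ b ℚ.+ η ℚ.- (a ℚ.- η) ℚ.+ η) →
      RationalCover (A ∩ Between a b) (fromℕ 12 ℚ.* η)
    choose {t} ¬At near (s₁ , s₂ , c₁ , c₂ , s≤) = cases (ℚₚ.≤-total s₁ s₂)
      where
      cases : s₁ ℚ.≤ s₂ ⊎ s₂ ℚ.≤ s₁ → RationalCover (A ∩ Between a b) (fromℕ 12 ℚ.* η)
      cases (inj₁ s₁≤s₂) = cover-⊆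
        (λ x (Ax , x∈) → Between-⊆ (a-η≤a a) (b≤b+η b) x x∈ , Ax)
        (ℚₚ.≤-trans (b≤b+η s₁) (bound s₁ s₂ s≤ s₁≤s₂)) c₁
      cases (inj₂ s₂≤s₁) = cover-⊆
        -- The widening by `η` absorbs the distance from `t` to `a + b`; membership of `t - x` in
        -- `A` would put `x + (t - x) = t` into `A`.
        (λ x (Ax , x∈) → Between-reflect {a} {b} {η} t near x x∈ , λ At-x →
          ¬At (subset (≃-pointwise (x + (t - x)) t (λ n →
              solve 2 (λ x t → x :+ (t :- x) := t) refl (seq x n) (seq t n)))
            (+-closed x (t - x) Ax At-x)))
        (bound s₂ s₁ (subst (ℚ._≤ b ℚ.+ η ℚ.- (a ℚ.- η) ℚ.+ η) (ℚₚ.+-comm s₁ s₂) s≤) s₂≤s₁)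
        (cover-reflect t 0<η c₂)

    reflected : ∃[ t ] (¬ A t × Near t (a ℚ.+ b) η) → RationalCover (A ∩ Between a b) (fromℕ 12 ℚ.* η)
    reflected (t , ¬At , near) = choose ¬At near
      (split em measurable (λ {x} {y} → Between-subset (a ℚ.- η) (b ℚ.+ η) {x} {y})
        (cover-interval (ℚₚ.≤-trans (a-η≤a a) (ℚₚ.≤-trans a≤b (b≤b+η b)))) 0<η)

  ¾ : ℚ
  ¾ = ½ ℚ.+ ½ ℚ.* ½

  cover-¾ : ∀ a b → a ℚ.≤ b → RationalCover (A ∩ Between a b) (¾ ℚ.* (b ℚ.- a))
  cover-¾ a b a≤b = cases (a ℚₚ.<? b)
    where
    0<16 : 0ℚ ℚ.< fromℕ 16
    0<16 = ℚₚ.positive⁻¹ (fromℕ 16)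

    nonempty : a ℚ.< b → ∃[ η ] fromℕ 16 ℚ.* η ≡ b ℚ.- a →
      RationalCover (A ∩ Between a b) (¾ ℚ.* (b ℚ.- a))
    nonempty a<b (η , eq) = subst₂ (λ b s → RationalCover (A ∩ Between a b) s)
      (trans (cong (a ℚ.+_) eq) (solve 2 (λ a b → a :+ (b :- a) := b) refl a b))
      (trans (solve 1 (λ e → con (fromℕ 12) :* e := con ¾ :* (con (fromℕ 16) :* e)) refl η)
        (cong (¾ ℚ.*_) eq))
      (cover-part a η (*-cancel-pos (ℚₚ.<⇒≤ 0<16) (subst (0ℚ ℚ.<_) (sym eq) 0<b-a)))
      where
      0<b-a : 0ℚ ℚ.< b ℚ.- a
      0<b-a = subst (ℚ._< b ℚ.- a) (ℚₚ.+-inverseʳ a) (ℚₚ.+-monoˡ-< (ℚ.- a) a<b)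

    cases : Dec (a ℚ.< b) → RationalCover (A ∩ Between a b) (¾ ℚ.* (b ℚ.- a))
    cases (yes a<b) = nonempty a<b (divide (b ℚ.- a) 0<16)
    cases (no a≮b)  = cover-empty (λ x (_ , x∈) → Between-empty (ℚₚ.≮⇒≥ a≮b) x x∈)
      (ℚₚ.nonNegative⁻¹ ¾ ⊛ gap a≤b)

  module _ {X : Pred ℝ 0ℓ} (X⊆A : ∀ x → X x → A x) where

    shrink : ∀ {s} → RationalCover X s → RationalCover X (¾ ℚ.* s)
    shrink {s} c = cover-⊆
      (λ x Xx → let i , x∈ = covers c x Xx in i , X⊆A x Xx , x∈) ℚₚ.≤-refl
      (cover-⋃ (λ i → cover-¾ (lower c i) (upper c i) (ordered c i)) λ n →
        subst (ℚ._≤ ¾ ℚ.* s) (sym (psum-* ¾ (λ i → upper c i ℚ.- lower c i) n))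
          (ℚₚ.*-monoˡ-≤-nonNeg ¾ (total c n)))

    -- Three rounds give `27/64`, which falls short of `1/2` by `5/64`; the estimates for `½^` then
    -- apply. The empty partial sum `total c 0` provides `0 ≤ s`.
    shrink-half : ∀ {s} → RationalCover X s → RationalCover X (½ ℚ.* s)
    shrink-half {s} c = cover-⊆ (λ _ Xx → Xx)
      (≤-gap (ℚₚ.nonNegative⁻¹ 5/64 ⊛ total c 0)
        (solve 1 (λ s → con ½ :* s :- con ¾ :* (con ¾ :* (con ¾ :* s)) := con 5/64 :* s) refl s))
      (shrink (shrink (shrink c)))
      where
      5/64 : ℚ
      5/64 = + 5 ℚ./ 64

    shrink-½^ : ∀ {s} n → RationalCover X s → RationalCover X (s ℚ.* ½^ n)
    shrink-½^ {s} zero    c = subst (RationalCover X) (sym (ℚₚ.*-identityʳ s)) c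
    shrink-½^ {s} (suc n) c = subst (RationalCover X)
      (solve 2 (λ s h → con ½ :* (s :* h) := s :* (con ½ :* h)) refl s (½^ n))
      (shrink-half (shrink-½^ n c))

    null : ∀ {s δ} → RationalCover X s → 0ℚ ℚ.< δ → RationalCover X δ
    null {s} c 0<δ = let n , small = ½^-small s 0<δ in cover-⊆ (λ _ Xx → Xx) small (shrink-½^ n c)

-- Density of the parts and the contradiction

module AdditivePartition
  {k} {H : Fin k → Pred ℝ 0ℓ}
  (subset : ∀ i → IsSubset (H i))
  (partition : ℝ⁺ ≐ ⋃ (Fin k) H)
  (disjoint : ∀ i j → i ≢ j → Empty (H i ∩ H j))
  (nonempty : ∀ i → Satisfiable (H i))
  (+-closed : ∀ i x y → x ∈ H i → y ∈ H i → x + y ∈ H i)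
  where

  multiple : ∀ {i} x n → H i x → H i (ι (fromℕ (suc n)) * x)
  multiple {i} x zero    Hx = subset i (≃-pointwise x (ι (fromℕ 1) * x) λ m →
    sym (ℚₚ.*-identityˡ (seq x m))) Hx
  multiple {i} x (suc n) Hx = subset i
    (≃-pointwise (x + ι (fromℕ (suc n)) * x) (ι (fromℕ (suc (suc n))) * x) λ m →
      trans (solve 2 (λ x k → x :+ k :* x := (con 1ℚ :+ k) :* x) refl (seq x m) (fromℕ (suc n)))
        (cong (ℚ._* seq x m) (sym (fromℕ-suc (suc n)))))
    (+-closed i x (ι (fromℕ (suc n)) * x) Hx (multiple x n Hx))

  member-unique : ∀ {i j} x → H i x → H j x → i ≡ j
  member-unique {i} {j} x Hi Hj =
    decidable-stable (i Finₚ.≟ j) λ i≢j → disjoint i j i≢j x (Hi , Hj)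

  -- The product `q x` is positive, so it lies in some part `H j`. With `(n + 1) q = m + 1`, the
  -- point `(m + 1) x` is a natural multiple both of `x` and of `q x`, hence lies in `H i` and in
  -- `H j`, and disjointness gives `i = j`.
  rational-multiple : ∀ {i} x q → 0ℚ ℚ.< q → H i x → H i (ι q * x)
  rational-multiple {i} x q 0<q Hx = same (proj₁ partition (positive (proj₂ partition (i , Hx))))
    (positive-fraction 0<q)
    where
    positive : 0ℝ < x → 0ℝ < ι q * x
    positive (ε , 0<ε , ev) = q ℚ.* ε , *-pos 0<q 0<ε , ev-map (λ n u →
      ≤-gap (ℚₚ.<⇒≤ 0<q ⊛ gap u)
        (solve 3 (λ q e x → q :* x :- (con 0ℚ :+ q :* e) := q :* (x :- (con 0ℚ :+ e))) refl
          q ε (seq x n))) ev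

    same : ∃[ j ] H j (ι q * x) → ∃[ m ] ∃[ n ] fromℕ (suc n) ℚ.* q ≡ fromℕ (suc m) → H i (ι q * x)
    same (j , Hqx) (m , n , eq) = subst (λ i → H i (ι q * x)) (sym i≡j) Hqx
      where
      i≡j : i ≡ j
      i≡j = member-unique (ι (fromℕ (suc m)) * x) (multiple x m Hx)
        (subset j (≃-pointwise (ι (fromℕ (suc n)) * (ι q * x)) (ι (fromℕ (suc m)) * x) λ r →
          trans (sym (ℚₚ.*-assoc (fromℕ (suc n)) q (seq x r))) (cong (ℚ._* seq x r) eq))
          (multiple (ι q * x) n Hqx))

  -- Scale a point `x` of `H i` by `q = d / p`, where the rational `p` is within `δ` of `x`. The
  -- result is within `q δ` of `d`. A positive lower bound `ε ≤ p` keeps `q` at most `d / ε`, so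
  -- choosing `d δ = ½ ε η` makes this error at most `η`.
  dense : ∀ i {d η} → 0ℚ ℚ.< d → 0ℚ ℚ.< η → ∃[ t ] (H i t × Near t d η)
  dense i {d} {η} 0<d 0<η = approach (nonempty i)
    where
    approach : ∃[ x ] H i x → ∃[ t ] (H i t × Near t d η)
    approach (x , Hx) = from-bounds (proj₂ partition (i , Hx))
      where
      scale : ∀ ε δ p q → 0ℚ ℚ.< ε → ε ℚ.≤ p → p ℚ.* q ≡ d → d ℚ.* δ ≡ ½ ℚ.* (ε ℚ.* η) →
        Near x p δ → ∃[ t ] (H i t × Near t d η)
      scale ε δ p q 0<ε ε≤p pq≡d dδ near = ι q * x , rational-multiple x q 0<q Hx , ev-map
        (λ n (u , v) →
          ≤-gap (0≤q ⊛ gap u ⊕ gap qδ≤η) (trans (cong (λ d → d ℚ.+ η ℚ.- q ℚ.* seq x n) (sym pq≡d))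
            (solve 5 (λ p q d e x → p :* q :+ e :- q :* x := q :* (p :+ d :- x) :+ (e :- q :* d))
              refl p q δ η (seq x n))) ,
          ≤-gap (0≤q ⊛ gap v ⊕ gap qδ≤η) (trans (cong (λ d → q ℚ.* seq x n ℚ.+ η ℚ.- d) (sym pq≡d))
            (solve 5 (λ p q d e x → q :* x :+ e :- p :* q := q :* (x :+ d :- p) :+ (e :- q :* d))
              refl p q δ η (seq x n)))) near
        where
        0<p : 0ℚ ℚ.< p
        0<p = ℚₚ.<-≤-trans 0<ε ε≤p
        0<q : 0ℚ ℚ.< q
        0<q = *-cancel-pos (ℚₚ.<⇒≤ 0<p) (subst (0ℚ ℚ.<_) (sym pq≡d) 0<d)
        0≤q : 0ℚ ℚ.≤ q
        0≤q = ℚₚ.<⇒≤ 0<q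
        qδ≤η : q ℚ.* δ ℚ.≤ η
        qδ≤η = *-cancel-≤ 0<p (≤-gap (gap ε≤p ⊛ ℚₚ.<⇒≤ 0<η ⊕ 0≤½ ⊛ ℚₚ.<⇒≤ (*-pos 0<ε 0<η))
          (trans (cong (λ w → p ℚ.* η ℚ.- w)
              (trans (sym (ℚₚ.*-assoc p q δ)) (trans (cong (ℚ._* δ) pq≡d) dδ)))
            (solve 3 (λ p e h → p :* h :- con ½ :* (e :* h) := (p :- e) :* h :+ con ½ :* (e :* h)) refl
              p ε η)))

      from-bounds : 0ℝ < x → ∃[ t ] (H i t × Near t d η)
      from-bounds (ε , 0<ε , M , h) =
        let δ , 0<δ , dδ = scaled 0<d (*-pos 0<ε 0<η)
            N , near     = cauchy x δ 0<δ
            K            = M ℕ.⊔ N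
            N≤K          = ℕₚ.m≤n⊔m M N
            ε≤p          = subst (ℚ._≤ seq x K) (ℚₚ.+-identityˡ ε) (h K (ℕₚ.m≤m⊔n M N))
            q , pq≡d     = divide d (ℚₚ.<-≤-trans 0<ε ε≤p)
        in scale ε δ (seq x K) q 0<ε ε≤p pq≡d dδ (N , λ n N≤n →
             distance-≤ (near n K N≤n N≤K) , distance-≤ (near K n N≤K N≤n))

  -- The intervals of a cover may lie anywhere on the line, so every rational `d` has to be
  -- approximated. For `d > 0` another part is dense; otherwise `d` itself is not positive and
  -- belongs to no part.
  outside : ∀ {i j} → i ≢ j → ∀ d η → 0ℚ ℚ.< η → ∃[ t ] (¬ H i t × Near t d η)
  outside {i} {j} i≢j d η 0<η = cases (0ℚ ℚₚ.<? d)
    where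
    cases : Dec (0ℚ ℚ.< d) → ∃[ t ] (¬ H i t × Near t d η)
    cases (yes 0<d) = let t , Ht , near = dense j 0<d 0<η in
      t , (λ Hi → i≢j (member-unique t Hi Ht)) , near
    cases (no 0≮d)  = ι d ,
      (λ Hd → let ε , 0<ε , ev = proj₂ partition (i , Hd) in
        0≮d (ℚₚ.<-≤-trans 0<ε (subst (ℚ._≤ d) (ℚₚ.+-identityˡ ε) (ev-const ev)))) ,
      0 , λ _ _ → d≤d+η , d≤d+η
      where
      d≤d+η : d ℚ.≤ d ℚ.+ η
      d≤d+η = ≤-gap (ℚₚ.<⇒≤ 0<η) (solve 2 (λ d e → d :+ e :- d := e) refl d η)

  -- Indexing the parts by ℕ, with empty sets from `k` on, allows a budget of `½^ (suc n)` for each.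
  -- The resulting cover of `[1 , 3]` has total at most 1, against the length 2.
  ¬all-measurable : ExcludedMiddle 0ℓ → (∀ i → ∃[ j ] i ≢ j) → ¬ (∀ i → LebesgueMeasurable (H i))
  ¬all-measurable em other measurable = <⇒≱ 1<3-1
    (length-≤-total (cover-⋃ {E} {geometric 1ℚ} {1ℚ} covered (psum-geometric-≤ 0<1)) em 1≤3 contains)
    where
    0<1 : 0ℚ ℚ.< 1ℚ
    0<1 = ℚₚ.positive⁻¹ 1ℚ

    1<3-1 : 1ℚ ℚ.< fromℕ 3 ℚ.- 1ℚ
    1<3-1 = toWitness {a? = 1ℚ ℚₚ.<? fromℕ 3 ℚ.- 1ℚ} tt

    1≤3 : 1ℚ ℚ.≤ fromℕ 3
    1≤3 = toWitness {a? = 1ℚ ℚₚ.≤? fromℕ 3} tt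

    E : ℕ → Pred ℝ 0ℓ
    E n x = ∃[ i ] (toℕ i ≡ n × H i x × Between 0ℚ (fromℕ 4) x)

    part : ∀ i {δ} → 0ℚ ℚ.< δ → RationalCover (H i ∩ Between 0ℚ (fromℕ 4)) δ
    part i = null em (subset i) (+-closed i) (measurable i) (outside (proj₂ (other i))) (λ _ → proj₁)
      -- The trivial cover of length 4 is the finite total from which the halving starts.
      (cover-⊆ (λ _ → proj₂) ℚₚ.≤-refl (cover-interval (0≤fromℕ 4)))

    covered : ∀ n → RationalCover (E n) (geometric 1ℚ n)
    covered n = cases (n ℕₚ.<? k)
      where
      cases : Dec (n ℕ.< k) → RationalCover (E n) (geometric 1ℚ n)
      cases (yes n<k) = cover-⊆ (λ { x (i , refl , Hx , x∈) →
          subst (λ i → H i x) (sym (Finₚ.fromℕ<-toℕ i n<k)) Hx , x∈ })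
        ℚₚ.≤-refl (part (fromℕ< n<k) (geometric-pos 0<1 n))
      cases (no n≮k)  = cover-empty (λ { x (i , refl , _) → n≮k (Finₚ.toℕ<n i) })
        (ℚₚ.<⇒≤ (geometric-pos 0<1 n))

    contains : ∀ x → ι 1ℚ ≤ x → x ≤ ι (fromℕ 3) → ⋃ ℕ E x
    contains x 1≤x x≤3 = let i , Hx = proj₁ partition 0<x in toℕ i , i , refl , Hx , 0<x , x<4
      where
      0<x : 0ℝ < x
      0<x = <-≤-trans {ι 0ℚ} {ι 1ℚ} {x} (1ℚ , 0<1 , 0 , λ _ _ → ℚₚ.≤-refl) 1≤x
      x<4 : x < ι (fromℕ 4)
      x<4 = ≤-<-trans {x} {ι (fromℕ 3)} {ι (fromℕ 4)} x≤3 (1ℚ , 0<1 , 0 , λ _ _ → ℚₚ.≤-refl)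

another : ∀ {k} → 2 ℕ.≤ k → (i : Fin k) → ∃[ j ] i ≢ j
another (ℕ.s≤s (ℕ.s≤s _)) Fin.zero    = Fin.suc Fin.zero , λ ()
another (ℕ.s≤s (ℕ.s≤s _)) (Fin.suc i) = Fin.zero , λ ()

theorem3p3 : ExcludedMiddle (lsuc 0ℓ) →
    (k : ℕ) → 2 ℕ.≤ k →
    (H : Fin k → Pred ℝ 0ℓ) →
    (∀ i → IsSubset (H i)) →
    ℝ⁺ ≐ ⋃ (Fin k) H →
    (∀ i j → i ≢ j → Empty (H i ∩ H j)) →
    (∀ i → Satisfiable (H i)) →
    (∀ i x y → x ∈ H i → y ∈ H i → x + y ∈ H i) →
    (∀ i x y → x ∈ H i → y ∈ H i → x * y ∈ H i) →
    ∃[ i ] ¬ LebesgueMeasurable (H i)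
theorem3p3 em k 2≤k H subset partition disjoint nonempty +-closed *-closed =
  -- Measurability quantifies over predicates and lives one universe up: `em` at that level extracts
  -- the index, and its lowered form carries the analysis.
  decidable-stable em λ none → ¬all-measurable (lower-em em) (another 2≤k)
    λ i → decidable-stable em λ ¬measurable → none (i , ¬measurable)
  where open AdditivePartition {k} {H} subset partition disjoint nonempty +-closed
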